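{- Let $(H_m)$ be a $p$-family of complete graphs, let $(G_m)$ be a $p$-family of graphs, and let $f_m=\hat f_{G_m,H_m}(\bar Z,\bar Y)$ be the generalised homomorphism polynomial (over all homomorphisms from $G_m$ to $H_m$). (i) If $(G_m)$ has bounded tree-width, then $(f_m)\in\mathsf{VP}$. (ii) If $(G_m)$ has bounded path-width, then $(f_m)\in\mathsf{VBP}$.
   Context: For undirected graphs $G,H$, a homomorphism $G\to H$ is a map $V(G)\to V(H)$ sending edges to edges. With variables $Z_{u,a}$ ($u\in V(G)$, $a\in V(H)$) and $Y_{(a,b)}$ ($(a,b)\in E(H)$), the generalised homomorphism polynomial is $\hat f_{G,H}=\sum_{\phi}\big(\prod_{u\in V(G)}Z_{u,\phi(u)}\big)\big(\prod_{(u,v)\in E(G)}Y_{(\phi(u),\phi(v))}\big)$, the sum over all homomorphisms $\phi:G\to H$. A sequence of graphs is a $p$-family if the number of vertices of $G_m$ is polynomially bounded in $m$; it has bounded tree-width (path-width) if some constant bounds the tree-width (path-width) of every graph in it. A $p$-family of polynomials has polynomially bounded number of variables and degree. $\mathsf{VP}$: $p$-families computed by polynomial-size arithmetic circuits; $\mathsf{VBP}$: $p$-families computed by polynomial-size skew arithmetic circuits (at every $\times$ gate at most one input is the output of another gate). -}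

module Defs where

open import Level using (Level; _⊔_)
open import Algebra.Bundles using (CommutativeRing)
open import Data.Bool.Base using (Bool; T)
open import Data.Empty using (⊥; ⊥-elim)
open import Data.Unit.Base using (⊤)
open import Data.Nat.Base using (ℕ; zero; suc; _+_; _*_; _^_; _≤_; NonZero)
open import Data.Fin.Base as Fin using (Fin; zero; suc; finToFun)
open import Data.Fin.Properties using (all?; <-cmp; _<?_)
open import Data.Fin.Subset using (Subset; _∈_; _∩_; _⊆_; ∣_∣)
open import Data.List.Base as List using (List; []; _∷_; allFin; cartesianProduct; foldr; length; map; mapMaybe)
import Data.List.Membership.Propositional as List∈
open import Data.List.Relation.Unary.All using (All)
open import Data.List.Relation.Unary.Unique.Propositional using (Unique)
open import Data.Maybe.Base as Maybe using (Maybe)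
open import Data.Product.Base using (Σ; ∃; ∃₂; _×_; _,_; proj₁; proj₂)
open import Function.Bundles using (_↣_)
open import Relation.Binary.Construct.Closure.ReflexiveTransitive using (Star; ε; _◅_)
open import Relation.Binary.Definitions using (tri<; tri≈; tri>)
open import Relation.Binary.PropositionalEquality.Core using (_≡_; _≢_; refl)
open import Relation.Nullary.Decidable.Core using (Dec; T?; dec⇒maybe; _×-dec_; _→-dec_)
open import Relation.Nullary.Negation.Core using (¬_)

-- Graphs are finite, simple and undirected. Boolean adjacency makes edge proofs
-- irrelevant, so that `Edge` below has exactly one element per edge.

record Graph : Set where
  field
    order : ℕ
    adj   : Fin order → Fin order → Bool

  Vertex : Set
  Vertex = Fin order

  _~_ : Vertex → Vertex → Set
  u ~ v = T (adj u v)

  field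
    ~-sym    : ∀ {u v} → u ~ v → v ~ u
    ~-irrefl : ∀ {u} → ¬ (u ~ u)

open Graph using (order; Vertex)

Complete : Graph → Set
Complete G = ∀ u v → u ≢ v → u ~ v
  where open Graph G using (_~_)

-- An undirected edge is stored with its endpoints in increasing order.

record Edge (G : Graph) : Set where
  constructor mkEdge
  open Graph G using (_~_)
  field
    src tgt  : Vertex G
    src<tgt  : src Fin.< tgt
    adjacent : src ~ tgt

edge : ∀ (G : Graph) u v → Graph._~_ G u v → Edge G
edge G u v u~v with <-cmp u v
... | tri< u<v _ _    = mkEdge u v u<v u~v
... | tri≈ _ refl _   = ⊥-elim (Graph.~-irrefl G u~v)
... | tri> _ _ v<u    = mkEdge v u v<u (Graph.~-sym G u~v)

edges : (G : Graph) → List (Edge G)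
edges G = mapMaybe edge? (cartesianProduct (allFin (order G)) (allFin (order G)))
  where
  edge? : Vertex G × Vertex G → Maybe (Edge G)
  edge? (u , v) = Maybe.map (λ { (u<v , u~v) → mkEdge u v u<v u~v })
                            (dec⇒maybe ((u <? v) ×-dec T? (Graph.adj G u v)))

IsHom : (G H : Graph) → (Vertex G → Vertex H) → Set
IsHom G H φ = ∀ u v → Graph._~_ G u v → Graph._~_ H (φ u) (φ v)

Hom : Graph → Graph → Set
Hom G H = Σ (Vertex G → Vertex H) (IsHom G H)

isHom? : ∀ G H φ → Dec (IsHom G H φ)
isHom? G H φ = all? λ u → all? λ v →
  T? (Graph.adj G u v) →-dec T? (Graph.adj H (φ u) (φ v))

-- `finToFun` enumerates all maps, each once, so each homomorphism is
-- listed exactly once (up to pointwise equality).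

homs : (G H : Graph) → List (Hom G H)
homs G H = mapMaybe (λ φ → Maybe.map (φ ,_) (dec⇒maybe (isHom? G H φ)))
                    (map finToFun (allFin (order H ^ order G)))

mapEdge : ∀ {G H} → Hom G H → Edge G → Edge H
mapEdge {H = H} (φ , pres) e = edge H (φ src) (φ tgt) (pres src tgt adjacent)
  where open Edge e

vertices : ∀ {A : Set} {_~_ : A → A → Set} {u v} → Star _~_ u v → List A
vertices {u = u} ε       = u ∷ []
vertices {u = u} (_ ◅ w) = u ∷ vertices w

record Path (G : Graph) (u v : Vertex G) : Set where
  field
    walk   : Star (Graph._~_ G) u v
    simple : Unique (vertices walk)

  support : List (Vertex G)
  support = vertices walk

-- A tree is a nonempty graph in which any two vertices are joined by
-- exactly one path.

record IsTree (T : Graph) : Set where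
  open Path using (support)
  field
    nonEmpty : NonZero (order T)
    path     : ∀ u v → Path T u v
    unique   : ∀ {u v} (p q : Path T u v) → support p ≡ support q

record TreeDecomposition (G : Graph) : Set where
  field
    tree     : Graph
    isTree   : IsTree tree
    bag      : Vertex tree → Subset (order G)
    vertex∈  : ∀ v → ∃ λ t → v ∈ bag t
    edge∈    : ∀ {u v} → Graph._~_ G u v → ∃ λ t → u ∈ bag t × v ∈ bag t
    coherent : ∀ {r s t} (p : Path tree r t) → s List∈.∈ Path.support p →
               bag r ∩ bag t ⊆ bag s

record PathDecomposition (G : Graph) : Set where
  field
    len      : ℕ
    bag      : Fin len → Subset (order G)
    vertex∈  : ∀ v → ∃ λ t → v ∈ bag t
    edge∈    : ∀ {u v} → Graph._~_ G u v → ∃ λ t → u ∈ bag t × v ∈ bag t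
    coherent : ∀ {r s t} → r Fin.≤ s → s Fin.≤ t → bag r ∩ bag t ⊆ bag s

-- The width of a decomposition is the maximal bag size minus one.

TreeWidth≤ : ℕ → Graph → Set
TreeWidth≤ k G = Σ (TreeDecomposition G) λ D →
  ∀ t → ∣ TreeDecomposition.bag D t ∣ ≤ suc k

PathWidth≤ : ℕ → Graph → Set
PathWidth≤ k G = Σ (PathDecomposition G) λ D →
  ∀ t → ∣ PathDecomposition.bag D t ∣ ≤ suc k

BoundedTreeWidth : (ℕ → Graph) → Set
BoundedTreeWidth G = ∃ λ k → ∀ m → TreeWidth≤ k (G m)

BoundedPathWidth : (ℕ → Graph) → Set
BoundedPathWidth G = ∃ λ k → ∀ m → PathWidth≤ k (G m)

PolyBounded : (ℕ → ℕ) → Set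
PolyBounded f = ∃₂ λ c k → ∀ m → f m ≤ c * m ^ k + c

IsGraphPFamily : (ℕ → Graph) → Set
IsGraphPFamily G = PolyBounded (λ m → order (G m))

data HomVar (G H : Graph) : Set where
  Z : Vertex G → Vertex H → HomVar G H
  Y : Edge H → HomVar G H

module _ {c ℓ : Level} (R : CommutativeRing c ℓ) where

  private module R = CommutativeRing R

  infixl 6 _⊕_
  infixl 7 _⊗_
  infix  4 _≋_

  -- Poly X with the equality _≋_ is R[X], presented as the free
  -- commutative R-algebra on X.

  data Poly (X : Set) : Set c where
    con     : R.Carrier → Poly X
    var     : X → Poly X
    _⊕_ _⊗_ : Poly X → Poly X → Poly X

  data _≋_ {X : Set} : Poly X → Poly X → Set (c ⊔ ℓ) where
    ≋-refl      : ∀ {p} → p ≋ p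
    ≋-sym       : ∀ {p q} → p ≋ q → q ≋ p
    ≋-trans     : ∀ {p q r} → p ≋ q → q ≋ r → p ≋ r
    ⊕-cong      : ∀ {p p′ q q′} → p ≋ p′ → q ≋ q′ → p ⊕ q ≋ p′ ⊕ q′
    ⊗-cong      : ∀ {p p′ q q′} → p ≋ p′ → q ≋ q′ → p ⊗ q ≋ p′ ⊗ q′
    ⊕-assoc     : ∀ p q r → (p ⊕ q) ⊕ r ≋ p ⊕ (q ⊕ r)
    ⊕-comm      : ∀ p q → p ⊕ q ≋ q ⊕ p
    ⊕-identityˡ : ∀ p → con R.0# ⊕ p ≋ p
    ⊗-assoc     : ∀ p q r → (p ⊗ q) ⊗ r ≋ p ⊗ (q ⊗ r)
    ⊗-comm      : ∀ p q → p ⊗ q ≋ q ⊗ p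
    ⊗-identityˡ : ∀ p → con R.1# ⊗ p ≋ p
    ⊗-zeroˡ     : ∀ p → con R.0# ⊗ p ≋ con R.0#
    ⊗-distribˡ  : ∀ p q r → p ⊗ (q ⊕ r) ≋ (p ⊗ q) ⊕ (p ⊗ r)
    con-cong    : ∀ {a b} → a R.≈ b → con a ≋ con b
    con-+       : ∀ a b → con (a R.+ b) ≋ con a ⊕ con b
    con-*       : ∀ a b → con (a R.* b) ≋ con a ⊗ con b

  ∑ ∏ : ∀ {X} → List (Poly X) → Poly X
  ∑ = foldr _⊕_ (con R.0#)
  ∏ = foldr _⊗_ (con R.1#)

  -- A term is a coefficient with a monomial, given as a list of
  -- variables with repetition.

  Term : Set → Set c
  Term X = R.Carrier × List X

  ⟦_⟧ₜ : ∀ {X} → Term X → Poly X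
  ⟦ a , xs ⟧ₜ = con a ⊗ ∏ (map var xs)

  Degree≤ : ∀ {X} → ℕ → Poly X → Set (c ⊔ ℓ)
  Degree≤ {X} d p = Σ (List (Term X)) λ ts →
    All (λ t → length (proj₂ t) ≤ d) ts × p ≋ ∑ (map ⟦_⟧ₜ ts)

  -- An input of a gate is the output of one of the n earlier gates
  -- (counted backwards, the latest being zero), a variable or a
  -- constant.

  data Input (X : Set) (n : ℕ) : Set c where
    gate     : Fin n → Input X n
    indet    : X → Input X n
    constant : R.Carrier → Input X n

  data Gate (X : Set) (n : ℕ) : Set c where
    plus times : Input X n → Input X n → Gate X n

  infixl 5 _▷_

  data Gates (X : Set) : ℕ → Set c where
    []  : Gates X zero
    _▷_ : ∀ {n} → Gates X n → Gate X n → Gates X (suc n)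

  record Circuit (X : Set) : Set c where
    field
      size   : ℕ
      gates  : Gates X size
      output : Input X size

  module _ {X : Set} where

    evalInput : ∀ {n} → (Fin n → Poly X) → Input X n → Poly X
    evalInput ρ (gate i)     = ρ i
    evalInput ρ (indet x)    = var x
    evalInput ρ (constant a) = con a

    evalGate : ∀ {n} → (Fin n → Poly X) → Gate X n → Poly X
    evalGate ρ (plus  i j) = evalInput ρ i ⊕ evalInput ρ j
    evalGate ρ (times i j) = evalInput ρ i ⊗ evalInput ρ j

    evalGates : ∀ {n} → Gates X n → Fin n → Poly X
    evalGates (gs ▷ g) zero    = evalGate (evalGates gs) g
    evalGates (gs ▷ g) (suc i) = evalGates gs i

    eval : Circuit X → Poly X
    eval C = evalInput (evalGates gates) output
      where open Circuit C

    _Computes_ : Circuit X → Poly X → Set (c ⊔ ℓ)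
    C Computes p = eval C ≋ p

    SkewGate : ∀ {n} → Gate X n → Set
    SkewGate (times (gate _) (gate _)) = ⊥
    SkewGate _                         = ⊤

    SkewGates : ∀ {n} → Gates X n → Set
    SkewGates []       = ⊤
    SkewGates (gs ▷ g) = SkewGates gs × SkewGate g

    Skew : Circuit X → Set
    Skew C = SkewGates (Circuit.gates C)

  record IsPFamily {X : ℕ → Set} (f : ∀ m → Poly (X m)) : Set (c ⊔ ℓ) where
    field
      numVars        : ℕ → ℕ
      variables      : ∀ m → X m ↣ Fin (numVars m)
      numVarsBounded : PolyBounded numVars
      degree         : ℕ → ℕ
      hasDegree      : ∀ m → Degree≤ (degree m) (f m)
      degreeBounded  : PolyBounded degree

  VP : {X : ℕ → Set} → (∀ m → Poly (X m)) → Set (c ⊔ ℓ)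
  VP {X} f = IsPFamily f × Σ (∀ m → Circuit (X m)) λ C →
    PolyBounded (λ m → Circuit.size (C m)) × (∀ m → C m Computes f m)

  VBP : {X : ℕ → Set} → (∀ m → Poly (X m)) → Set (c ⊔ ℓ)
  VBP {X} f = IsPFamily f × Σ (∀ m → Circuit (X m)) λ C →
    PolyBounded (λ m → Circuit.size (C m)) ×
    (∀ m → Skew (C m)) × (∀ m → C m Computes f m)

  f̂ : (G H : Graph) → Poly (HomVar G H)
  f̂ G H = ∑ (map monomial (homs G H))
    where
    monomial : Hom G H → Poly (HomVar G H)
    monomial φ =
      ∏ (map (λ u → var (Z u (proj₁ φ u))) (allFin (order G))) ⊗
      ∏ (map (λ e → var (Y (mapEdge φ e))) (edges G))

{-# OPTIONS --safe #-}

-- A map that is not a homomorphism contributes zero once Y is replaced by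
-- zero on pairs of values that are not adjacent, so f̂ is a sum over all maps
-- of a product of factors, each depending on one vertex or one edge of G.
-- Vertices are summed out one at a time: those factors that contain the
-- current vertex v are multiplied and v is summed over, which yields a new
-- factor. If v runs through the vertices by decreasing depth of their topmost
-- bag, then the new factor depends only on that bag of v, so its table has at
-- most |H| ^ (k + 1) entries, whatever the number of bags. On a path
-- decomposition, where depth is the index of the first bag, the factor just
-- computed can be multiplied into the next one at every step; all other
-- factors are still variables or zero, and the circuit is skew.

module Submission where

open import Defs hiding (_≋_; ∑; ∏)
open import Algebra.Bundles using (CommutativeRing; CommutativeSemiring)
import Algebra.Properties.CommutativeSemigroup as CommutativeSemigroupProperties
import Algebra.Structures.Biased as Biased
open import Data.Bool.Base using (true; false)
open import Data.Bool.Properties using (T-irrelevant)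
open import Data.Empty using (⊥-elim)
open import Data.Fin.Base as Fin using (Fin; zero; suc; toℕ; finToFun; combine; _↑ˡ_; _↑ʳ_)
import Data.Fin.Properties as Fin
open import Data.Fin.Subset using (Subset; inside; outside; _∈_; ∣_∣; ⁅_⁆; _∪_) renaming (⊥ to ∅)
open import Data.Fin.Subset.Properties using (_∈?_; ∉⊥; x∈⁅x⁆; x∈⁅y⁆⇒x≡y; x∈p∪q⁺; x∈p∪q⁻; x∈p∩q⁺)
open import Data.List.Base using (List; []; _∷_; _++_; length; map; mapMaybe; foldr; allFin; tabulate; filter; lookup; cartesianProduct; cartesianProductWith)
open import Data.List.Membership.Propositional using () renaming (_∈_ to _∈ˡ_)
open import Data.List.Membership.Propositional.Properties using (∈-allFin; ∈-cartesianProduct⁺; ∈-cartesianProductWith⁺; ∈-map⁺; ∈-filter⁺; ∈-filter⁻)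
open import Data.List.Properties using (map-++; map-∘; map-tabulate; length-++; length-map; length-tabulate; length-filter; length-mapMaybe)
open import Data.List.Relation.Binary.Permutation.Propositional as Perm using (_↭_; prep; swap)
open import Data.List.Relation.Binary.Permutation.Propositional.Properties using (↭-length; ∈-resp-↭)
open import Data.List.Relation.Binary.Subset.Propositional using () renaming (_⊆_ to _⊆ˡ_)
open import Data.List.Relation.Binary.Subset.Propositional.Properties using (⊆-refl; ⊆-trans; xs⊆x∷xs; Any-resp-⊆)
open import Data.List.Relation.Unary.All as All using (All; []; _∷_)
import Data.List.Relation.Unary.All.Properties as All
open import Data.List.Relation.Unary.AllPairs using (AllPairs; []; _∷_)
open import Data.List.Relation.Unary.Any as Any using (Any; here; there; any?)
import Data.List.Relation.Unary.Any.Properties as Any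
open import Data.List.Relation.Unary.Sorted.TotalOrder.Properties using (Sorted⇒AllPairs)
open import Data.List.Relation.Unary.Unique.Propositional using (Unique)
import Data.List.Sort as Sort
open import Data.Maybe.Base as Maybe using (Maybe)
import Data.Maybe.Relation.Unary.Any as MAny
open import Data.Nat.Base using (ℕ; zero; suc; _+_; _*_; _^_; _≤_; z≤n; s≤s; >-nonZero⁻¹)
open import Data.Nat.Properties
open import Data.List.Extrema ≤-totalOrder using (argmin; f[argmin]≤f[xs]; argmin-all)
open import Data.Product.Base using (Σ; ∃; ∃₂; _×_; _,_; proj₁; proj₂)
open import Data.Sum.Base using (_⊎_; inj₁; inj₂; [_,_]′)
open import Data.Unit.Base using (⊤; tt)
open import Data.Vec.Base as Vec using ([]; _∷_)
open import Data.Vec.Functional as Vector using (updateAt)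
open import Data.Vec.Functional.Properties using (updateAt-updates; updateAt-minimal; updateAt-commutes)
open import Function.Base using (_∘_; id; const; case_of_)
open import Function.Bundles using (mk↣)
open import Level using (Level; _⊔_)
open import Relation.Binary.Bundles using (DecTotalOrder)
import Relation.Binary.Construct.Flip.EqAndOrd as Flip
import Relation.Binary.Construct.On as On
open import Relation.Binary.Construct.Closure.ReflexiveTransitive using (Star; ε; _◅_; _◅◅_)
open import Relation.Binary.Construct.Closure.ReflexiveTransitive.Properties using (◅◅-assoc)
open import Relation.Binary.Definitions using (tri<; tri≈; tri>)
open import Relation.Binary.PropositionalEquality as ≡ using (_≡_; _≢_; _≗_; refl; sym; trans; cong; cong₂; subst)
import Relation.Binary.Reasoning.Setoid as SetoidReasoning
open import Relation.Binary.Structures using (IsEquivalence)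
open import Relation.Nullary
open import Relation.Nullary.Decidable.Core using (T?; dec⇒maybe; ¬?; _→-dec_; _×-dec_)

open Graph using (order; Vertex)

-- Polynomially bounded functions

module _ where
  open ≤-Reasoning
  open CommutativeSemigroupProperties *-commutativeSemigroup using () renaming (interchange to ℕ-interchange)

  ^-distribʳ-* : ∀ k a b → (a * b) ^ k ≡ a ^ k * b ^ k
  ^-distribʳ-* zero    a b = refl
  ^-distribʳ-* (suc k) a b rewrite ^-distribʳ-* k a b =
    ℕ-interchange a b (a ^ k) (b ^ k)

  -- Products of such bounds are again of this form; for c * m ^ k + c they are
  -- not, and m ^ k is not monotone in k at m = 0.
  PolyBounded′ : (ℕ → ℕ) → Set
  PolyBounded′ f = ∃₂ λ c k → ∀ m → f m ≤ c * suc m ^ k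

  fromPolyBounded : ∀ {f} → PolyBounded f → PolyBounded′ f
  fromPolyBounded {f} (c , k , b) = c + c , k , λ m → begin
    f m                           ≤⟨ b m ⟩
    c * m ^ k + c                 ≤⟨ +-mono-≤ (*-monoʳ-≤ c (^-monoˡ-≤ k (n≤1+n m)))
                                              (m≤m*n c (suc m ^ k) {{m^n≢0 (suc m) k}}) ⟩
    c * suc m ^ k + c * suc m ^ k ≡⟨ *-distribʳ-+ (suc m ^ k) c c ⟨
    (c + c) * suc m ^ k           ∎

  -- For positive `m`, `suc m` is at most `2 * m`, which costs the factor `2 ^ k`; the additive
  -- constant covers `m = 0`.
  toPolyBounded : ∀ {f} → PolyBounded′ f → PolyBounded f
  toPolyBounded {f} (c , k , b) = c * 2 ^ k , k , bound
    where
    bound : ∀ m → f m ≤ c * 2 ^ k * m ^ k + c * 2 ^ k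
    bound zero = begin
      f 0                               ≤⟨ b 0 ⟩
      c * 1 ^ k                         ≤⟨ *-monoʳ-≤ c (^-monoˡ-≤ k (s≤s (z≤n {1}))) ⟩
      c * 2 ^ k                         ≤⟨ m≤n+m _ _ ⟩
      c * 2 ^ k * 0 ^ k + c * 2 ^ k     ∎
    bound m@(suc m-1) = begin
      f m                               ≤⟨ b m ⟩
      c * suc m ^ k                     ≤⟨ *-monoʳ-≤ c (^-monoˡ-≤ k (s≤s (m≤n+m m m-1))) ⟩
      c * (m + m) ^ k                   ≡⟨ cong (λ x → c * (m + x) ^ k) (+-identityʳ m) ⟨
      c * (2 * m) ^ k                   ≡⟨ cong (c *_) (^-distribʳ-* k 2 m) ⟩
      c * (2 ^ k * m ^ k)               ≡⟨ *-assoc c (2 ^ k) (m ^ k) ⟨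
      c * 2 ^ k * m ^ k                 ≤⟨ m≤m+n _ _ ⟩
      c * 2 ^ k * m ^ k + c * 2 ^ k     ∎

  mono-polyBounded : ∀ {f g} → (∀ m → f m ≤ g m) → PolyBounded′ g → PolyBounded′ f
  mono-polyBounded f≤g (c , k , b) = c , k , λ m → ≤-trans (f≤g m) (b m)

  const-polyBounded : ∀ c → PolyBounded′ (λ _ → c)
  const-polyBounded c = c , 0 , λ m → ≤-reflexive (sym (*-identityʳ c))

  +-polyBounded : ∀ {f g} → PolyBounded′ f → PolyBounded′ g → PolyBounded′ (λ m → f m + g m)
  +-polyBounded {f} {g} (c , k , b) (d , l , b′) = c + d , k + l , λ m → begin
    f m + g m                               ≤⟨ +-mono-≤ (b m) (b′ m) ⟩
    c * suc m ^ k + d * suc m ^ l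
      ≤⟨ +-mono-≤ (*-monoʳ-≤ c (^-monoʳ-≤ (suc m) (m≤m+n k l)))
                  (*-monoʳ-≤ d (^-monoʳ-≤ (suc m) (m≤n+m l k))) ⟩
    c * suc m ^ (k + l) + d * suc m ^ (k + l) ≡⟨ *-distribʳ-+ _ c d ⟨
    (c + d) * suc m ^ (k + l)               ∎

  *-polyBounded : ∀ {f g} → PolyBounded′ f → PolyBounded′ g → PolyBounded′ (λ m → f m * g m)
  *-polyBounded {f} {g} (c , k , b) (d , l , b′) = c * d , k + l , λ m → begin
    f m * g m                           ≤⟨ *-mono-≤ (b m) (b′ m) ⟩
    c * suc m ^ k * (d * suc m ^ l)     ≡⟨ ℕ-interchange c (suc m ^ k) d (suc m ^ l) ⟩
    c * d * (suc m ^ k * suc m ^ l)     ≡⟨ cong (c * d *_) (^-distribˡ-+-* (suc m) k l) ⟨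
    c * d * suc m ^ (k + l)             ∎

  ^-polyBounded : ∀ {f} → PolyBounded′ f → ∀ e → PolyBounded′ (λ m → f m ^ e)
  ^-polyBounded b zero    = const-polyBounded 1
  ^-polyBounded b (suc e) = *-polyBounded b (^-polyBounded b e)

-- Elimination schemes

-- In skew mode at most one operand of a product may be the output of a gate.

data Mode : Set where
  general skew : Mode

-- The message of u has scope S. In general mode it is multiplied in when the
-- first vertex of S is eliminated. In skew mode it must be consumed at once,
-- whether or not the next vertex v lies in S, so that a single computed
-- factor is carried along.

Consumes : ∀ {n} → Mode → Subset n → Fin n → Set
Consumes general S v = v ∈ S
Consumes skew    S v = ⊤

-- Vertices are eliminated by decreasing rank, and the message sent by v
-- depends on vertices of front v only.

record Scheme (mode : Mode) (k : ℕ) (G : Graph) : Set where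
  open Graph G using (_~_)
  field
    rank   : Vertex G → ℕ
    front  : Vertex G → Subset (order G)
    small  : ∀ v → ∣ front v ∣ ≤ suc k
    self   : ∀ v → v ∈ front v
    edge∈  : ∀ {v w} → v ~ w → rank w ≤ rank v → w ∈ front v
    -- This lets the message of `u` be multiplied into that of `v` without leaving `front v`. Ranks
    -- are compared weakly, so vertices of equal rank may come in any order.
    closed : ∀ {u v w} → rank v ≤ rank u → rank w ≤ rank v →
             Consumes mode (front u) v → w ∈ front u → w ∈ front v

argmin-∃ : ∀ {N} (d : Fin N → ℕ) {P : Fin N → Set} → (∀ t → Dec (P t)) → ∃ P →
           ∃ λ s → P s × (∀ {t} → P t → d s ≤ d t)
argmin-∃ {N} d {P} P? (t₀ , p₀) =
  argmin d t₀ ts ,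
  argmin-all d p₀ (All.all-filter P? (allFin N)) ,
  λ {t} p → All.lookup (f[argmin]≤f[xs] t₀ ts) (∈-filter⁺ P? (∈-allFin t) p)
  where ts = filter P? (allFin N)

module _ {G : Graph} {N : ℕ} (bag : Fin N → Subset (order G))
         (vertex∈ : ∀ v → ∃ λ t → v ∈ bag t) (depth : Fin N → ℕ) where

  top-∃ : ∀ v → ∃ λ s → v ∈ bag s × (∀ {t} → v ∈ bag t → depth s ≤ depth t)
  top-∃ v = argmin-∃ depth (λ t → v ∈? bag t) (vertex∈ v)

  top : Vertex G → Fin N
  top v = proj₁ (top-∃ v)

  v∈top : ∀ v → v ∈ bag (top v)
  v∈top v = proj₁ (proj₂ (top-∃ v))

  top-min : ∀ {v t} → v ∈ bag t → depth (top v) ≤ depth t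
  top-min {v} = proj₂ (proj₂ (top-∃ v))

-- The bags that contain `w` form an interval. In `closed` the ranks alone place `front v` between
-- the first bag of `w` and `front u`, so `w` lies in it, as skew mode demands.
pathScheme : ∀ {k G} → PathWidth≤ k G → Scheme skew k G
pathScheme {k} {G} (D , small) = record
  { rank   = toℕ ∘ top′
  ; front  = bag ∘ top′
  ; small  = λ v → small (top′ v)
  ; self   = v∈top {G} bag vertex∈ toℕ
  ; edge∈  = λ v~w w≤v → let (t , v∈ , w∈) = edge∈ v~w in
             coherent w≤v (top-min {G} bag vertex∈ toℕ v∈)
               (x∈p∩q⁺ (v∈top {G} bag vertex∈ toℕ _ , w∈))
  ; closed = λ v≤u w≤v _ w∈ → coherent w≤v v≤u
               (x∈p∩q⁺ (v∈top {G} bag vertex∈ toℕ _ , w∈))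
  }
  where
  open PathDecomposition D
  top′ = top {G} bag vertex∈ toℕ

-- Rooted trees

module _ {A : Set} {_~_ : A → A → Set} where

  source∈ : ∀ {u v} (p : Star _~_ u v) → u ∈ˡ vertices p
  source∈ ε       = here refl
  source∈ (_ ◅ _) = here refl

  target∈ : ∀ {u v} (p : Star _~_ u v) → v ∈ˡ vertices p
  target∈ ε       = here refl
  target∈ (_ ◅ p) = there (target∈ p)

  prefix⊆ : ∀ {u v w x} (p : Star _~_ u v) (q : Star _~_ v w) →
            x ∈ˡ vertices p → x ∈ˡ vertices (p ◅◅ q)
  prefix⊆ ε       q (here refl) = source∈ q
  prefix⊆ (_ ◅ _) q (here refl) = here refl
  prefix⊆ (_ ◅ p) q (there x∈)  = there (prefix⊆ p q x∈)

  suffix⊆ : ∀ {u v w x} (p : Star _~_ u v) (q : Star _~_ v w) →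
            x ∈ˡ vertices q → x ∈ˡ vertices (p ◅◅ q)
  suffix⊆ ε       q x∈ = x∈
  suffix⊆ (_ ◅ p) q x∈ = there (suffix⊆ p q x∈)

  ∈-◅◅⁻ : ∀ {u v w x} (p : Star _~_ u v) (q : Star _~_ v w) →
          x ∈ˡ vertices (p ◅◅ q) → x ∈ˡ vertices p ⊎ x ∈ˡ vertices q
  ∈-◅◅⁻ ε       q x∈          = inj₂ x∈
  ∈-◅◅⁻ (_ ◅ p) q (here refl) = inj₁ (here refl)
  ∈-◅◅⁻ (_ ◅ p) q (there x∈)  = [ inj₁ ∘ there , inj₂ ]′ (∈-◅◅⁻ p q x∈)

  unique-prefix : ∀ {u v w} (p : Star _~_ u v) (q : Star _~_ v w) →
                  Unique (vertices (p ◅◅ q)) → Unique (vertices p)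
  unique-prefix ε       q _        = [] ∷ []
  unique-prefix (_ ◅ p) q (u∉ ∷ uq) =
    All.tabulate (λ x∈ → All.lookup u∉ (prefix⊆ p q x∈)) ∷ unique-prefix p q uq

  unique-suffix : ∀ {u v w} (p : Star _~_ u v) (q : Star _~_ v w) →
                  Unique (vertices (p ◅◅ q)) → Unique (vertices q)
  unique-suffix ε       q uq       = uq
  unique-suffix (_ ◅ p) q (_ ∷ uq) = unique-suffix p q uq

  splitAt-∈ : ∀ {u v x} (p : Star _~_ u v) → x ∈ˡ vertices p →
              ∃₂ λ (q : Star _~_ u x) (r : Star _~_ x v) → p ≡ q ◅◅ r
  splitAt-∈ ε       (here refl) = ε , ε , refl
  splitAt-∈ (e ◅ p) (here refl) = ε , e ◅ p , refl
  splitAt-∈ (e ◅ p) (there x∈)  with splitAt-∈ p x∈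
  ... | q , r , refl = e ◅ q , r , refl

  -- Every edge of `p` puts one more vertex in front of those of `q`, so only the empty walk `p`
  -- keeps the length.
  length-suffix : ∀ {u v w} (p : Star _~_ u v) (q : Star _~_ v w) →
                  length (vertices (p ◅◅ q)) ≤ length (vertices q) → u ≡ v
  length-suffix ε       q _  = refl
  length-suffix (e ◅ p) q le = ⊥-elim (<-irrefl refl (≤-trans (s≤s (suffix≤ p q)) le))
    where
    suffix≤ : ∀ {u v w} (p : Star _~_ u v) (q : Star _~_ v w) →
              length (vertices q) ≤ length (vertices (p ◅◅ q))
    suffix≤ ε       q = ≤-refl
    suffix≤ (_ ◅ p) q = m≤n⇒m≤1+n (suffix≤ p q)

module _ {T : Graph} (isTree : IsTree T) (r : Vertex T) where
  open Graph T using (_~_; ~-sym; ~-irrefl)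
  open IsTree isTree
  open Path

  toRoot : ∀ t → Path T t r
  toRoot t = path t r

  ancestors : Vertex T → List (Vertex T)
  ancestors t = support (toRoot t)

  depth : Vertex T → ℕ
  depth t = length (ancestors t)

  -- A suffix of a simple walk is simple, so uniqueness of paths identifies it with the path from
  -- `s` to the root.
  ancestors-suffix : ∀ {t s} (q : Star _~_ t s) (q′ : Star _~_ s r) → walk (toRoot t) ≡ q ◅◅ q′ →
                     vertices q′ ≡ ancestors s
  ancestors-suffix {t} {s} q q′ eq = unique
    (record { walk = q′ ; simple = unique-suffix q q′ (subst (Unique ∘ vertices) eq (simple (toRoot t))) })
    (toRoot s)

  ancestors-∷ : ∀ {s t} → s ~ t → ¬ (s ∈ˡ ancestors t) → ancestors s ≡ s ∷ ancestors t
  ancestors-∷ {s} {t} s~t s∉ = unique (toRoot s)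
    (record { walk   = s~t ◅ walk (toRoot t)
            ; simple = All.¬Any⇒All¬ _ s∉ ∷ simple (toRoot t) })

  -- One of two neighbours is the parent of the other. If the path from `t` to the root avoids `s`,
  -- then `s` can be put in front of it. Otherwise its part from `s` on avoids `t`, which can be put
  -- in front of that part.
  adjacent-ancestors : ∀ {s t} → s ~ t → ancestors s ≡ s ∷ ancestors t ⊎ ancestors t ≡ t ∷ ancestors s
  adjacent-ancestors {s} {t} s~t with any? (s Fin.≟_) (ancestors t)
  ... | no s∉  = inj₁ (ancestors-∷ s~t s∉)
  ... | yes s∈ with splitAt-∈ (walk (toRoot t)) s∈
  ... | ε , _ , _ = ⊥-elim (~-irrefl s~t)
  ... | e ◅ q , q′ , eq = inj₂ (ancestors-∷ (~-sym s~t) λ t∈ → t∉ (t∈suffix t∈))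
    where
    simple′ : Unique (vertices (e ◅ q ◅◅ q′))
    simple′ = subst (Unique ∘ vertices) eq (simple (toRoot t))
    t∉ : ¬ (t ∈ˡ vertices (q ◅◅ q′))
    t∉ with simple′
    ... | t∉′ ∷ _ = All.All¬⇒¬Any t∉′
    t∈suffix : t ∈ˡ ancestors s → t ∈ˡ vertices (q ◅◅ q′)
    t∈suffix t∈ = suffix⊆ q q′ (subst (t ∈ˡ_) (sym (ancestors-suffix (e ◅ q) q′ eq)) t∈)

  -- Induction along the walk. If the first edge leads to the parent, `t` inherits the ancestors of
  -- the parent. If it leads to a child, only that child is lost, and it is not `s`, because `t` is
  -- less deep.
  minimum-ancestor : ∀ {s t} (w : Star _~_ t s) → (∀ {x} → x ∈ˡ vertices w → depth s ≤ depth x) →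
                     s ∈ˡ ancestors t
  minimum-ancestor ε       _   = source∈ _
  minimum-ancestor {s} {t} (e ◅ w) min with adjacent-ancestors e | minimum-ancestor w (min ∘ there)
  ... | inj₁ eq | s∈ = subst (s ∈ˡ_) (sym eq) (there s∈)
  ... | inj₂ eq | s∈ with subst (s ∈ˡ_) eq s∈
  ...   | there s∈t = s∈t
  ...   | here refl = ⊥-elim (<-irrefl refl (≤-trans (≤-reflexive (sym (cong length eq))) (min (here refl))))

  -- Both lie on the path from `t` to the root, along which depth decreases, so the shallower `s′`
  -- comes last.
  deeper-between : ∀ {s s′ t} → s ∈ˡ ancestors t → s′ ∈ˡ ancestors t → depth s′ ≤ depth s →
                   ∃ λ (p : Path T t s′) → s ∈ˡ support p
  deeper-between {s} {s′} {t} s∈ s′∈ le with splitAt-∈ (walk (toRoot t)) s′∈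
  ... | q , q′ , eq = record { walk = q ; simple = unique-prefix q q′ simple′ } , s∈q
    where
    simple′ : Unique (vertices (q ◅◅ q′))
    simple′ = subst (Unique ∘ vertices) eq (simple (toRoot t))
    s∈q : s ∈ˡ vertices q
    s∈q with ∈-◅◅⁻ q q′ (subst (λ w → s ∈ˡ vertices w) eq s∈)
    ... | inj₁ s∈q = s∈q
    -- Here `s` lies on the part that starts at `s′`; the depths force the walk between the two to
    -- be empty.
    ... | inj₂ s∈q′ with splitAt-∈ q′ s∈q′
    ... | q₁ , q₂ , refl with length-suffix q₁ q₂ (begin
        length (vertices (q₁ ◅◅ q₂))  ≡⟨ cong length (ancestors-suffix q (q₁ ◅◅ q₂) eq) ⟩
        depth s′                      ≤⟨ le ⟩
        depth s                       ≡⟨ cong length (ancestors-suffix (q ◅◅ q₁) q₂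
                                           (trans eq (sym (◅◅-assoc q q₁ q₂)))) ⟨
        length (vertices q₂)          ∎)
      where
      open ≤-Reasoning
    ... | refl = target∈ q

-- Everything reduces to `share`, for two vertices with a common bag. For an edge this is the bag
-- that covers it; for `closed` it is `front u`, which contains `v` because general mode consumes a
-- message only at a vertex of its scope.
treeScheme : ∀ {k G} → TreeWidth≤ k G → Scheme general k G
treeScheme {k} {G} (D , small) = record
  { rank   = depth′ ∘ top′
  ; front  = bag ∘ top′
  ; small  = λ v → small (top′ v)
  ; self   = v∈top′
  ; edge∈  = λ v~w w≤v → let (t , v∈ , w∈) = edge∈ v~w in share v∈ w∈ w≤v
  ; closed = λ _ w≤v v∈ w∈ → share v∈ w∈ w≤v
  }
  where
  open TreeDecomposition D
  -- Any vertex can be the root; nonemptiness provides the one of index 0.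
  root : Vertex tree
  root = Fin.fromℕ< (>-nonZero⁻¹ (order tree) {{IsTree.nonEmpty isTree}})
  depth′ = depth isTree root
  top′   = top {G} bag vertex∈ depth′
  v∈top′ = v∈top {G} bag vertex∈ depth′

  -- By coherence all bags on the path from `t` to `top′ v` contain `v`, and `top′ v` has least
  -- depth among the bags with `v`.
  top-ancestor : ∀ {v t} → v ∈ bag t → top′ v ∈ˡ ancestors isTree root t
  top-ancestor {v} {t} v∈ = minimum-ancestor isTree root (Path.walk p) λ x∈ →
    top-min {G} bag vertex∈ depth′ (coherent p x∈ (x∈p∩q⁺ (v∈ , v∈top′ v)))
    where p = IsTree.path isTree t (top′ v)

  -- Both top bags are ancestors of `t` and that of `v` is the deeper one, so it lies on the path
  -- from `t` to `top′ w`, whose two ends contain `w`.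
  share : ∀ {v w t} → v ∈ bag t → w ∈ bag t → depth′ (top′ w) ≤ depth′ (top′ v) → w ∈ bag (top′ v)
  share {v} {w} v∈ w∈ le =
    let (p , v∈p) = deeper-between isTree root (top-ancestor v∈) (top-ancestor w∈) le
    in coherent p v∈p (x∈p∩q⁺ (w∈ , v∈top′ w))

-- Assignments that vary on a set of vertices

elements : ∀ {n} → Subset n → List (Fin n)
elements []            = []
elements (inside  ∷ S) = zero ∷ map suc (elements S)
elements (outside ∷ S) = map suc (elements S)

length-elements : ∀ {n} (S : Subset n) → length (elements S) ≡ ∣ S ∣
length-elements []            = refl
length-elements (inside  ∷ S) = cong suc (trans (length-map suc (elements S)) (length-elements S))
length-elements (outside ∷ S) = trans (length-map suc (elements S)) (length-elements S)

∈-elements : ∀ {n} {S : Subset n} {v} → v ∈ S → v ∈ˡ elements S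
∈-elements Vec.here                            = here refl
∈-elements {S = inside  ∷ S} (Vec.there v∈S) = there (∈-map⁺ suc (∈-elements v∈S))
∈-elements {S = outside ∷ S} (Vec.there v∈S) = ∈-map⁺ suc (∈-elements v∈S)

length-cartesianProductWith : ∀ {A B C : Set} (f : A → B → C) xs ys →
                              length (cartesianProductWith f xs ys) ≡ length xs * length ys
length-cartesianProductWith f []       ys = refl
length-cartesianProductWith f (x ∷ xs) ys = trans
  (length-++ (map (f x) ys))
  (cong₂ _+_ (length-map (f x) ys) (length-cartesianProductWith f xs ys))

module _ {n h : ℕ} where

  infixl 9 _[_≔_]

  _[_≔_] : (Fin n → Fin h) → Fin n → Fin h → Fin n → Fin h
  ψ [ v ≔ a ] = updateAt ψ v (const a)

  []≔-agree : ∀ (ψ φ : Fin n → Fin h) v {a w} → (v ≢ w → ψ w ≡ φ w) →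
              (ψ [ v ≔ a ]) w ≡ (φ [ v ≔ a ]) w
  []≔-agree ψ φ v {a} {w} agree with w Fin.≟ v
  ... | yes refl = trans (updateAt-updates w ψ) (sym (updateAt-updates w φ))
  ... | no w≢v     = trans (updateAt-minimal w v ψ w≢v)
                       (trans (agree (w≢v ∘ sym)) (sym (updateAt-minimal w v φ w≢v)))

  -- The rows of a table for a factor with scope `us`; outside `us` the values are the defaults
  -- given by `ψ`.
  variants : (Fin n → Fin h) → List (Fin n) → List (Fin n → Fin h)
  variants ψ []       = ψ ∷ []
  variants ψ (u ∷ us) = cartesianProductWith (λ φ a → φ [ u ≔ a ]) (variants ψ us) (allFin h)

  length-variants : ∀ ψ us → length (variants ψ us) ≡ h ^ length us
  length-variants ψ []       = refl
  length-variants ψ (u ∷ us) = begin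
    length (variants ψ (u ∷ us))               ≡⟨ length-cartesianProductWith _ (variants ψ us) (allFin h) ⟩
    length (variants ψ us) * length (allFin h) ≡⟨ cong₂ _*_ (length-variants ψ us) (length-tabulate {n = h} id) ⟩
    h ^ length us * h                          ≡⟨ *-comm (h ^ length us) h ⟩
    h * h ^ length us                          ∎
    where open ≡.≡-Reasoning

  ∈-variants : ∀ ψ us (φ : Fin n → Fin h) →
               ∃ λ ρ → ρ ∈ˡ variants ψ us × (∀ {w} → w ∈ˡ us → ρ w ≡ φ w)
  ∈-variants ψ []       φ = ψ , here refl , λ ()
  ∈-variants ψ (u ∷ us) φ with ∈-variants ψ us φ
  ... | ρ , ρ∈ , agree =
    ρ [ u ≔ φ u ] , ∈-cartesianProductWith⁺ _ ρ∈ (∈-allFin (φ u)) , agree′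
    where
    agree′ : ∀ {w} → w ∈ˡ u ∷ us → (ρ [ u ≔ φ u ]) w ≡ φ w
    agree′ {w} w∈ with w Fin.≟ u | w∈
    ... | yes refl | _         = updateAt-updates w ρ
    ... | no w≢u     | here w≡u  = ⊥-elim (w≢u w≡u)
    ... | no w≢u     | there w∈′ = trans (updateAt-minimal w u ρ w≢u) (agree w∈′)

-- The commutative semiring of polynomials

module _ {c ℓ : Level} (R : CommutativeRing c ℓ) (X : Set) where

  private module R = CommutativeRing R

  polySemiring : CommutativeSemiring c (c ⊔ ℓ)
  polySemiring = record
    { Carrier = Poly R X
    ; _≈_ = Defs._≋_ R
    ; _+_ = _⊕_
    ; _*_ = _⊗_
    ; 0#  = con R.0#
    ; 1#  = con R.1#
    ; isCommutativeSemiring = Biased.isCommutativeSemiringʳ record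
      { +-isCommutativeMonoid = Biased.isCommutativeMonoidˡ record
        { isSemigroup = record
          { isMagma = record { isEquivalence = isEquivalence ; ∙-cong = ⊕-cong }
          ; assoc   = ⊕-assoc }
        ; identityˡ = ⊕-identityˡ
        ; comm      = ⊕-comm }
      ; *-isCommutativeMonoid = Biased.isCommutativeMonoidˡ record
        { isSemigroup = record
          { isMagma = record { isEquivalence = isEquivalence ; ∙-cong = ⊗-cong }
          ; assoc   = ⊗-assoc }
        ; identityˡ = ⊗-identityˡ
        ; comm      = ⊗-comm }
      ; distribˡ = ⊗-distribˡ
      ; zeroʳ    = λ p → ≋-trans (⊗-comm p (con R.0#)) (⊗-zeroˡ p) } }
    where
    isEquivalence : IsEquivalence (Defs._≋_ R {X})
    isEquivalence = record { refl = ≋-refl ; sym = ≋-sym ; trans = ≋-trans }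

-- Sums over assignments

module Sums {c ℓ} (R : CommutativeRing c ℓ) {X : Set} where

  open CommutativeSemiring (polySemiring R X) public
    using (_≈_; 0#; 1#; setoid; reflexive)
    renaming (+-identityʳ to ⊕-identityʳ; *-identityʳ to ⊗-identityʳ; zeroʳ to ⊗-zeroʳ; distribʳ to ⊗-distribʳ)
  open CommutativeSemigroupProperties
    (CommutativeSemiring.+-commutativeSemigroup (polySemiring R X)) public
    using () renaming (interchange to ⊕-interchange)
  open CommutativeSemigroupProperties
    (CommutativeSemiring.*-commutativeSemigroup (polySemiring R X)) public
    using () renaming (x∙yz≈y∙xz to ⊗-swap)
  open SetoidReasoning setoid

  ∑ ∏ : List (Poly R X) → Poly R X
  ∑ = Defs.∑ R
  ∏ = Defs.∏ R

  private variable
    a b : Level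
    A : Set a
    B : Set b

  ∑-cong : {f g : A → Poly R X} → (∀ x → f x ≈ g x) → ∀ xs → ∑ (map f xs) ≈ ∑ (map g xs)
  ∑-cong f≈g []       = ≋-refl
  ∑-cong f≈g (x ∷ xs) = ⊕-cong (f≈g x) (∑-cong f≈g xs)

  ∑-zero : ∀ (xs : List A) → ∑ (map (const 0#) xs) ≈ 0#
  ∑-zero []       = ≋-refl
  ∑-zero (x ∷ xs) = ≋-trans (⊕-identityˡ _) (∑-zero xs)

  ∑-⊕ : ∀ (f g : A → Poly R X) xs → ∑ (map (λ x → f x ⊕ g x) xs) ≈ ∑ (map f xs) ⊕ ∑ (map g xs)
  ∑-⊕ f g []       = ≋-sym (⊕-identityˡ _)
  ∑-⊕ f g (x ∷ xs) = ≋-trans (⊕-cong ≋-refl (∑-⊕ f g xs)) (⊕-interchange _ _ _ _)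

  ∑-comm : ∀ (f : A → B → Poly R X) xs ys →
           ∑ (map (λ x → ∑ (map (f x) ys)) xs) ≈ ∑ (map (λ y → ∑ (map (λ x → f x y) xs)) ys)
  ∑-comm f []       ys = ≋-sym (∑-zero ys)
  ∑-comm f (x ∷ xs) ys = ≋-trans (⊕-cong ≋-refl (∑-comm f xs ys)) (≋-sym (∑-⊕ _ _ ys))

  ∑-⊗ʳ : ∀ (f : A → Poly R X) p xs → ∑ (map (λ x → f x ⊗ p) xs) ≈ ∑ (map f xs) ⊗ p
  ∑-⊗ʳ f p []       = ≋-sym (⊗-zeroˡ p)
  ∑-⊗ʳ f p (x ∷ xs) = ≋-trans (⊕-cong ≋-refl (∑-⊗ʳ f p xs))
    (≋-sym (⊗-distribʳ p _ _))

  ∑-tabulate-+ : ∀ m {n} (f : Fin (m + n) → Poly R X) →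
                 ∑ (tabulate f) ≈ ∑ (tabulate (f ∘ (_↑ˡ n))) ⊕ ∑ (tabulate (f ∘ (m ↑ʳ_)))
  ∑-tabulate-+ zero    f = ≋-sym (⊕-identityˡ _)
  ∑-tabulate-+ (suc m) f = ≋-trans (⊕-cong ≋-refl (∑-tabulate-+ m (f ∘ suc))) (≋-sym (⊕-assoc _ _ _))

  ∑-tabulate-combine : ∀ m k (f : Fin (m * k) → Poly R X) →
    ∑ (tabulate f) ≈ ∑ (tabulate (λ a → ∑ (tabulate (λ j → f (combine {m} {k} a j)))))
  ∑-tabulate-combine zero    k f = ≋-refl
  ∑-tabulate-combine (suc m) k f =
    ≋-trans (∑-tabulate-+ k f) (⊕-cong ≋-refl (∑-tabulate-combine m k (f ∘ (k ↑ʳ_))))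

  ∑-combine : ∀ m k (f : Fin (m * k) → Poly R X) →
    ∑ (map f (allFin (m * k))) ≈ ∑ (map (λ a → ∑ (map (f ∘ combine {m} {k} a) (allFin k))) (allFin m))
  ∑-combine m k f = begin
    ∑ (map f (allFin (m * k)))                               ≡⟨ cong ∑ (map-tabulate id f) ⟩
    ∑ (tabulate f)                                           ≈⟨ ∑-tabulate-combine m k f ⟩
    ∑ (tabulate (λ a → ∑ (tabulate (f ∘ combine {m} {k} a)))) ≡⟨ cong ∑ (map-tabulate {n = m} id _) ⟨
    ∑ (map (λ a → ∑ (tabulate (f ∘ combine {m} {k} a))) (allFin m))
      ≈⟨ ∑-cong (λ a → reflexive
                         (cong ∑ (sym (map-tabulate id (f ∘ combine {m} {k} a))))) (allFin m) ⟩
    ∑ (map (λ a → ∑ (map (f ∘ combine {m} {k} a) (allFin k))) (allFin m)) ∎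

  ∏-cong : {f g : A → Poly R X} → ∀ {xs} → All (λ x → f x ≈ g x) xs → ∏ (map f xs) ≈ ∏ (map g xs)
  ∏-cong []        = ≋-refl
  ∏-cong (eq ∷ eqs) = ⊗-cong eq (∏-cong eqs)

  ∏-++ : ∀ ps qs → ∏ (ps ++ qs) ≈ ∏ ps ⊗ ∏ qs
  ∏-++ []       qs = ≋-sym (⊗-identityˡ _)
  ∏-++ (p ∷ ps) qs = ≋-trans (⊗-cong ≋-refl (∏-++ ps qs)) (≋-sym (⊗-assoc _ _ _))

  ∏-zero : ∀ {ps} → Any (_≈ 0#) ps → ∏ ps ≈ 0#
  ∏-zero (here p≈0)  = ≋-trans (⊗-cong p≈0 ≋-refl) (⊗-zeroˡ _)
  ∏-zero (there any) = ≋-trans (⊗-cong ≋-refl (∏-zero any)) (⊗-zeroʳ _)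

  ∏-filter : ∀ {P : A → Set} (P? : ∀ x → Dec (P x)) (f : A → Poly R X) xs →
             ∏ (map f xs) ≈ ∏ (map f (filter P? xs)) ⊗ ∏ (map f (filter (¬? ∘ P?) xs))
  ∏-filter P? f []       = ≋-sym (⊗-identityˡ _)
  ∏-filter P? f (x ∷ xs) with does (P? x)
  ... | true  = ≋-trans (⊗-cong ≋-refl (∏-filter P? f xs)) (≋-sym (⊗-assoc _ _ _))
  ... | false = ≋-trans (⊗-cong ≋-refl (∏-filter P? f xs)) (⊗-swap _ _ _)

  -- The left side is the form that programs compute: `p` and then the running product stay in the
  -- right operand, while each factor of `qs` enters on the left, as skewness requires.
  foldr-⊗ : ∀ p qs → foldr _⊗_ p qs ≈ p ⊗ ∏ qs
  foldr-⊗ p []       = ≋-sym (⊗-identityʳ p)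
  foldr-⊗ p (q ∷ qs) = ≋-trans (⊗-cong ≋-refl (foldr-⊗ p qs)) (⊗-swap _ _ _)

  module _ {h : ℕ} where

    -- Decoding an index and updating entries in another order give assignments that agree only
    -- pointwise; this condition allows passing between them.
    Extensional : ∀ {n} → ((Fin n → Fin h) → Poly R X) → Set (c ⊔ ℓ)
    Extensional F = ∀ {ψ φ} → ψ ≗ φ → F ψ ≈ F φ

    sumOut : ∀ {n} → Fin n → ((Fin n → Fin h) → Poly R X) → (Fin n → Fin h) → Poly R X
    sumOut v F ψ = ∑ (map (λ a → F (ψ [ v ≔ a ])) (allFin h))

    -- The head of the list becomes the innermost sum, that is, it is eliminated first.
    sumOutAll : ∀ {n} → List (Fin n) → ((Fin n → Fin h) → Poly R X) → (Fin n → Fin h) → Poly R X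
    sumOutAll []       F = F
    sumOutAll (v ∷ vs) F = sumOutAll vs (sumOut v F)

    sumOut-cong : ∀ {n} (v : Fin n) {F F′} → (∀ ψ → F ψ ≈ F′ ψ) → ∀ ψ → sumOut v F ψ ≈ sumOut v F′ ψ
    sumOut-cong v F≈F′ ψ = ∑-cong (λ a → F≈F′ (ψ [ v ≔ a ])) (allFin h)

    sumOutAll-cong : ∀ {n} (vs : List (Fin n)) {F F′} → (∀ ψ → F ψ ≈ F′ ψ) →
                     ∀ ψ → sumOutAll vs F ψ ≈ sumOutAll vs F′ ψ
    sumOutAll-cong []       F≈F′ = F≈F′
    sumOutAll-cong (v ∷ vs) F≈F′ = sumOutAll-cong vs (sumOut-cong v F≈F′)

    sumOut-ext : ∀ {n} (v : Fin n) {F} → Extensional F → Extensional (sumOut v F)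
    sumOut-ext v ext {ψ} {φ} ψ≗φ = ∑-cong (λ a → ext (λ w → []≔-agree ψ φ v (λ _ → ψ≗φ w))) (allFin h)

    sumOut-comm : ∀ {n} (v w : Fin n) {F} → Extensional F →
                  ∀ ψ → sumOut v (sumOut w F) ψ ≈ sumOut w (sumOut v F) ψ
    sumOut-comm v w {F} ext ψ with v Fin.≟ w
    ... | yes refl = ≋-refl
    ... | no v≢w     = ≋-trans
      (∑-cong (λ a → ∑-cong (λ b → ext (updateAt-commutes w v (v≢w ∘ sym) ψ)) (allFin h)) (allFin h))
      (∑-comm (λ a b → F (ψ [ w ≔ b ] [ v ≔ a ])) (allFin h) (allFin h))

    -- Frees the elimination order from the order in which the enumeration of all maps lists the
    -- vertices.
    sumOutAll-↭ : ∀ {n} {vs ws : List (Fin n)} {F} → Extensional F → vs ↭ ws →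
                  ∀ ψ → sumOutAll vs F ψ ≈ sumOutAll ws F ψ
    sumOutAll-↭ ext Perm.refl          ψ = ≋-refl
    sumOutAll-↭ ext (prep v vs↭ws)     ψ = sumOutAll-↭ (sumOut-ext v ext) vs↭ws ψ
    sumOutAll-↭ {F = F} ext (swap {xs = vs} v w vs↭ws) ψ = ≋-trans
      (sumOutAll-cong vs (sumOut-comm w v {F} ext) ψ)
      (sumOutAll-↭ (sumOut-ext v (sumOut-ext w ext)) vs↭ws ψ)
    sumOutAll-↭ ext (Perm.trans us↭vs vs↭ws) ψ = ≋-trans (sumOutAll-↭ ext us↭vs ψ) (sumOutAll-↭ ext vs↭ws ψ)

    ∷-η : ∀ {n} (ψ : Fin (suc n) → Fin h) → ψ ≗ (ψ zero Vector.∷ ψ ∘ suc)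
    ∷-η ψ zero    = refl
    ∷-η ψ (suc v) = refl

    sumOutAll-map-suc : ∀ {n} (us : List (Fin n)) {F} → Extensional F → ∀ ψ →
      sumOutAll (map suc us) F ψ ≈ sumOutAll us (λ φ → F (ψ zero Vector.∷ φ)) (ψ ∘ suc)
    sumOutAll-map-suc []       ext ψ = ext (∷-η ψ)
    sumOutAll-map-suc (u ∷ us) ext ψ = ≋-trans
      (sumOutAll-map-suc us (sumOut-ext (suc u) ext) ψ)
      (sumOutAll-cong us (λ φ → ∑-cong (λ a → ext (∷-η _)) (allFin h)) (ψ ∘ suc))

    -- The index of a map combines its value at `zero` with the index of the remaining map, so the
    -- sum splits off one coordinate. The start `ψ` is arbitrary since every entry gets overwritten.
    ∑-finToFun : ∀ n {F} → Extensional F → ∀ ψ →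
      ∑ (map F (map finToFun (allFin (h ^ n)))) ≈ sumOutAll (allFin n) F ψ
    ∑-finToFun zero    ext ψ = ≋-trans (⊕-identityʳ _) (ext (λ ()))
    ∑-finToFun (suc n) {F} ext ψ = begin
      ∑ (map F (map finToFun (allFin (h * h ^ n))))
        ≡⟨ cong ∑ (map-∘ (allFin (h * h ^ n))) ⟨
      ∑ (map (F ∘ finToFun) (allFin (h * h ^ n)))
        ≈⟨ ∑-combine h (h ^ n) (F ∘ finToFun) ⟩
      ∑ (map (λ a → ∑ (map (F ∘ finToFun ∘ combine a) js)) (allFin h))
        ≈⟨ ∑-cong (λ a → ∑-cong (λ j → ext (finToFun-combine a j)) js) (allFin h) ⟩
      ∑ (map (λ a → ∑ (map (λ j → F (a Vector.∷ finToFun j)) js)) (allFin h))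
        -- `sumOutAll` sums its head innermost, so the sum over the value at `zero` has to move
        -- inside.
        ≈⟨ ∑-comm _ (allFin h) js ⟩
      ∑ (map (λ j → ∑ (map (λ a → F (a Vector.∷ finToFun j)) (allFin h))) js)
        ≡⟨ cong ∑ (map-∘ js) ⟩
      ∑ (map (λ φ → ∑ (map (λ a → F (a Vector.∷ φ)) (allFin h))) (map finToFun js))
        ≈⟨ ∑-finToFun n (λ ψ≗φ → ∑-cong (λ a → ext (∷-cong ψ≗φ)) (allFin h)) (ψ ∘ suc) ⟩
      sumOutAll (allFin n) (λ φ → ∑ (map (λ a → F (a Vector.∷ φ)) (allFin h))) (ψ ∘ suc)
        ≈⟨ sumOutAll-cong (allFin n) (λ φ → ∑-cong (λ a → ext (∷-η _)) (allFin h)) (ψ ∘ suc) ⟨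
      sumOutAll (allFin n) (λ φ → sumOut zero F (ψ zero Vector.∷ φ)) (ψ ∘ suc)
        ≈⟨ sumOutAll-map-suc (allFin n) (sumOut-ext zero ext) ψ ⟨
      sumOutAll (map suc (allFin n)) (sumOut zero F) ψ
        ≡⟨ cong (λ vs → sumOutAll vs (sumOut zero F) ψ) (map-tabulate id suc) ⟩
      sumOutAll (allFin (suc n)) F ψ ∎
      where
      js = allFin (h ^ n)
      ∷-cong : ∀ {a : Fin h} {ψ φ : Fin n → Fin h} → ψ ≗ φ → (a Vector.∷ ψ) ≗ (a Vector.∷ φ)
      ∷-cong ψ≗φ zero    = refl
      ∷-cong ψ≗φ (suc v) = ψ≗φ v
      finToFun-combine : ∀ (a : Fin h) (j : Fin (h ^ n)) →
                         finToFun {h} {suc n} (combine a j) ≗ (a Vector.∷ finToFun j)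
      finToFun-combine a j zero    = cong proj₁ (Fin.remQuot-combine a j)
      finToFun-combine a j (suc v) = cong (λ aj → finToFun {h} {n} (proj₂ aj) v) (Fin.remQuot-combine a j)

-- Arithmetic programs

-- A circuit is handled as the list of the polynomials computed at its gates,
-- the latest gate first.

module Programs {c ℓ} (R : CommutativeRing c ℓ) (X : Set) (mode : Mode) where

  open Sums R {X}

  -- Taken up to `≈`, here and in `Available`, so that rewriting a polynomial by an identity costs
  -- no gate.
  Atomic : Poly R X → Set (c ⊔ ℓ)
  Atomic p = (∃ λ x → var x ≈ p) ⊎ (∃ λ a → con a ≈ p)

  Available : List (Poly R X) → Poly R X → Set (c ⊔ ℓ)
  Available ps p = Atomic p ⊎ Any (_≈ p) ps

  Multiplier : List (Poly R X) → Poly R X → Set (c ⊔ ℓ)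
  Multiplier ps p = Atomic p ⊎ (mode ≡ general × Available ps p)

  data Program : List (Poly R X) → Set (c ⊔ ℓ) where
    []    : Program []
    plus  : ∀ {ps p q} → Program ps → Available ps p → Available ps q → Program (p ⊕ q ∷ ps)
    times : ∀ {ps p q} → Program ps → Multiplier ps p → Available ps q → Program (p ⊗ q ∷ ps)

  atomic-cong : ∀ {p q} → p ≈ q → Atomic p → Atomic q
  atomic-cong p≈q (inj₁ (x , eq)) = inj₁ (x , ≋-trans eq p≈q)
  atomic-cong p≈q (inj₂ (a , eq)) = inj₂ (a , ≋-trans eq p≈q)

  available-cong : ∀ {ps p q} → p ≈ q → Available ps p → Available ps q
  available-cong p≈q (inj₁ at)  = inj₁ (atomic-cong p≈q at)
  available-cong p≈q (inj₂ p∈) = inj₂ (Any.map (λ eq → ≋-trans eq p≈q) p∈)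

  available-⊆ : ∀ {ps qs p} → ps ⊆ˡ qs → Available ps p → Available qs p
  available-⊆ ps⊆qs (inj₁ at) = inj₁ at
  available-⊆ ps⊆qs (inj₂ p∈) = inj₂ (Any-resp-⊆ ps⊆qs p∈)

  multiplier-⊆ : ∀ {ps qs p} → ps ⊆ˡ qs → Multiplier ps p → Multiplier qs p
  multiplier-⊆ ps⊆qs (inj₁ at)        = inj₁ at
  multiplier-⊆ ps⊆qs (inj₂ (eq , av)) = inj₂ (eq , available-⊆ ps⊆qs av)

  latest : ∀ {ps p} → Available (p ∷ ps) p
  latest = inj₂ (here ≋-refl)

  atomInput : ∀ {p} n → Atomic p → Input R X n
  atomInput n (inj₁ (x , _)) = indet x
  atomInput n (inj₂ (a , _)) = constant a

  evalInput-atom : ∀ {n p} (ρ : Fin n → Poly R X) (at : Atomic p) → evalInput R ρ (atomInput n at) ≈ p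
  evalInput-atom ρ (inj₁ (x , eq)) = eq
  evalInput-atom ρ (inj₂ (a , eq)) = eq

  input : ∀ {ps p} → Available ps p → Input R X (length ps)
  input (inj₁ at)  = atomInput _ at
  input (inj₂ p∈) = gate (Any.index p∈)

  evalInput-input : ∀ {ps p} (ρ : Fin (length ps) → Poly R X) → (∀ i → ρ i ≈ lookup ps i) →
                    (av : Available ps p) → evalInput R ρ (input av) ≈ p
  evalInput-input ρ ρ≈ (inj₁ at)  = evalInput-atom ρ at
  evalInput-input ρ ρ≈ (inj₂ p∈) = ≋-trans (ρ≈ (Any.index p∈)) (lookup-index p∈)
    where
    lookup-index : ∀ {ps p} (p∈ : Any (_≈ p) ps) → lookup ps (Any.index p∈) ≈ p
    lookup-index (here eq)  = eq
    lookup-index (there p∈) = lookup-index p∈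

  record Compiled (ps : List (Poly R X)) : Set (c ⊔ ℓ) where
    field
      gates   : Gates R X (length ps)
      correct : ∀ i → evalGates R gates i ≈ lookup ps i
      isSkew  : mode ≡ skew → SkewGates R gates
  open Compiled

  multiplierInput : ∀ {ps p} (C : Compiled ps) → Multiplier ps p →
    Σ (Input R X (length ps)) λ i → evalInput R (evalGates R (gates C)) i ≈ p ×
      (mode ≡ skew → ∀ j → SkewGate R (times i j))
  multiplierInput C (inj₁ at) = atomInput _ at , evalInput-atom _ at , λ _ → atom-skew at
    where
    atom-skew : ∀ {n p} (at : Atomic p) (j : Input R X n) → SkewGate R (times (atomInput n at) j)
    atom-skew (inj₁ _) j = tt
    atom-skew (inj₂ _) j = tt
  multiplierInput C (inj₂ (refl , av)) = input av , evalInput-input _ (correct C) av , λ ()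

  compile : ∀ {ps} → Program ps → Compiled ps
  compile [] = record { gates = [] ; correct = λ () ; isSkew = λ _ → tt }
  compile (plus prog p q) = record
    { gates   = gates C ▷ plus (input p) (input q)
    ; correct = λ { zero    → ⊕-cong (evalInput-input _ (correct C) p) (evalInput-input _ (correct C) q)
                  ; (suc i) → correct C i }
    ; isSkew  = λ m≡skew → isSkew C m≡skew , tt
    }
    where C = compile prog
  compile (times {ps} {p} {q} prog p× qav) = record
    { gates   = gates C ▷ times (proj₁ left) (input qav)
    ; correct = λ { zero    → ⊗-cong (proj₁ (proj₂ left)) (evalInput-input _ (correct C) qav)
                  ; (suc i) → correct C i }
    ; isSkew  = λ m≡skew → isSkew C m≡skew , proj₂ (proj₂ left) m≡skew (input qav)
    }
    where
    C    = compile prog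
    left = multiplierInput C p×

  infix 4 _reaches_within_

  -- A state monad with the program as state: `cost` bounds the number of added gates, and `extends`
  -- keeps earlier results usable.
  record _reaches_within_ {t} (ps : List (Poly R X)) (T : List (Poly R X) → Set t) (cost : ℕ) :
                          Set (c ⊔ ℓ ⊔ t) where
    constructor reached
    field
      {final} : List (Poly R X)
      program : Program final
      extends : ps ⊆ˡ final
      bound   : length final ≤ cost + length ps
      goal    : T final
  open _reaches_within_ public

  module _ {t} {T : List (Poly R X) → Set t} where

    done : ∀ {ps cost} → Program ps → T ps → ps reaches T within cost
    done {ps} prog goal = reached prog ⊆-refl (m≤n+m (length ps) _) goal

    weaken : ∀ {ps cost cost′} → cost ≤ cost′ → ps reaches T within cost → ps reaches T within cost′
    weaken {ps} le (reached prog ext b g) = reached prog ext (≤-trans b (+-monoˡ-≤ (length ps) le)) g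

    emit : ∀ {ps p cost} → Program (p ∷ ps) → T (p ∷ ps) → ps reaches T within suc cost
    emit {ps} {p} prog goal = reached prog (xs⊆x∷xs ps p) (s≤s (m≤n+m (length ps) _)) goal

    _>>=_ : ∀ {u} {U : List (Poly R X) → Set u} {ps cost₁ cost₂} → ps reaches T within cost₁ →
            (∀ {qs} → Program qs → ps ⊆ˡ qs → T qs → qs reaches U within cost₂) →
            ps reaches U within cost₁ + cost₂
    _>>=_ {ps = ps} {cost₁} {cost₂} (reached {qs} prog ext b g) k with k prog ext g
    ... | reached {rs} prog′ ext′ b′ g′ = reached prog′ (⊆-trans ext ext′) (begin
        length rs                     ≤⟨ b′ ⟩
        cost₂ + length qs             ≤⟨ +-monoʳ-≤ cost₂ b ⟩
        cost₂ + (cost₁ + length ps)   ≡⟨ +-assoc cost₂ cost₁ (length ps) ⟨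
        cost₂ + cost₁ + length ps     ≡⟨ cong (_+ length ps) (+-comm cost₂ cost₁) ⟩
        cost₁ + cost₂ + length ps     ∎) g′
      where open ≤-Reasoning

  -- `build` has to work in every extension of `ps`, because the gates for earlier entries are
  -- already present when its turn comes.
  reach-each : ∀ {A : Set} (f : A → Poly R X) cost {ps} (xs : List A) →
    (∀ x {qs} → Program qs → ps ⊆ˡ qs → qs reaches (λ rs → Available rs (f x)) within cost) →
    Program ps → ps reaches (λ rs → All (λ x → Available rs (f x)) xs) within length xs * cost
  reach-each f cost []       build prog = done prog []
  reach-each f cost (x ∷ xs) build prog =
    build x prog ⊆-refl >>= λ prog′ ps⊆qs av →
    let reached prog″ qs⊆rs b avs = reach-each f cost xs (λ y prog ⊆ → build y prog (⊆-trans ps⊆qs ⊆)) prog′ in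
    reached prog″ qs⊆rs b (available-⊆ qs⊆rs av ∷ avs)

  reach-∑ : ∀ {ps} qs → Program ps → All (Available ps) qs →
            ps reaches (λ rs → Available rs (∑ qs)) within length qs
  reach-∑ []       prog []         = done prog (inj₁ (inj₂ (_ , ≋-refl)))
  reach-∑ {ps} (q ∷ qs) prog (av ∷ avs) = weaken (≤-reflexive (+-comm (length qs) 1))
    (reach-∑ qs prog avs >>= λ prog′ ⊆ av′ → emit (plus prog′ (available-⊆ ⊆ av) av′) latest)

  reach-foldr-⊗ : ∀ {ps} p qs → Program ps → Available ps p → All (Multiplier ps) qs →
                  ps reaches (λ rs → Available rs (foldr _⊗_ p qs)) within length qs
  reach-foldr-⊗ p []       prog av []         = done prog av
  reach-foldr-⊗ {ps} p (q ∷ qs) prog av (m ∷ ms) = weaken (≤-reflexive (+-comm (length qs) 1))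
    (reach-foldr-⊗ p qs prog av ms >>= λ prog′ ⊆ av′ → emit (times prog′ (multiplier-⊆ ⊆ m) av′) latest)

-- Vertex elimination

module Elimination {c ℓ} (R : CommutativeRing c ℓ) (X : Set) {mode k G} (scheme : Scheme mode k G) (h : ℕ) where

  open Sums R {X}
  open Programs R X mode
  open Scheme scheme
  open SetoidReasoning setoid

  Assignment : Set
  Assignment = Vertex G → Fin h

  record Factor : Set c where
    field
      scope : Subset (order G)
      value : Assignment → Poly R X
  open Factor public

  -- Only the vertices `vs` still to be eliminated count: the scope of a message is a whole front
  -- and may contain eliminated vertices, on which the value no longer depends.
  Supported : List (Vertex G) → Factor → Set (c ⊔ ℓ)
  Supported vs F = ∀ ψ φ → (∀ {w} → w ∈ˡ vs → w ∈ scope F → ψ w ≡ φ w) → value F ψ ≈ value F φ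

  -- The invariant of the main factor, which is multiplied in at the next vertex whether or not its
  -- scope contains it.
  Covered : List (Vertex G) → Factor → Set
  Covered vs F = ∀ {v w} → v ∈ˡ vs → w ∈ˡ vs → w ∈ scope F → rank w ≤ rank v → w ∈ front v

  -- The invariant of the waiting factors, each multiplied in only at a vertex of its scope.
  Clique : List (Vertex G) → Factor → Set
  Clique vs F = ∀ {v w} → v ∈ˡ vs → w ∈ˡ vs → v ∈ scope F → w ∈ scope F → rank w ≤ rank v → w ∈ front v

  -- After the first step of an elimination in skew mode `main` is the latest message; in general
  -- mode it is always the unit, and messages wait in `Fs`.
  product : Factor → List Factor → Assignment → Poly R X
  product main Fs ψ = value main ψ ⊗ ∏ (map (λ F → value F ψ) Fs)

  message : Vertex G → Factor → List Factor → Factor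
  message v main touched = record
    { scope = front v
    ; value = sumOut v (λ ψ → foldr _⊗_ (value main ψ) (map (λ F → value F ψ) touched))
    }

  -- All factors involved have their uneliminated scope inside `front v`: `main` by `Covered`, the
  -- touched ones by `Clique` at `v` itself. The elimination order supplies the rank comparison that
  -- both ask for.
  message-supported : ∀ {v vs main touched} →
    (∀ {w} → w ∈ˡ vs → rank w ≤ rank v) → Covered (v ∷ vs) main → Supported (v ∷ vs) main →
    All (λ F → v ∈ scope F × Clique (v ∷ vs) F × Supported (v ∷ vs) F) touched →
    Supported vs (message v main touched)
  message-supported {v} {vs} {main} {touched} rank≤ cov sup good ψ φ agree = ∑-cong (λ a → begin
      foldr _⊗_ (value main (ψ [ v ≔ a ])) (map (λ F → value F (ψ [ v ≔ a ])) touched)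
        ≈⟨ foldr-⊗ _ (map (λ F → value F (ψ [ v ≔ a ])) touched) ⟩
      value main (ψ [ v ≔ a ]) ⊗ ∏ (map (λ F → value F (ψ [ v ≔ a ])) touched)
        ≈⟨ ⊗-cong (sup _ _ λ w∈ w∈S → agree′ w∈ (cov (here refl) w∈ w∈S))
                  (∏-cong (All.map (λ { (v∈S , cl , sup′) → sup′ _ _ λ w∈ w∈S →
                             agree′ w∈ (cl (here refl) w∈ v∈S w∈S) }) good)) ⟩
      value main (φ [ v ≔ a ]) ⊗ ∏ (map (λ F → value F (φ [ v ≔ a ])) touched)
        ≈⟨ foldr-⊗ _ (map (λ F → value F (φ [ v ≔ a ])) touched) ⟨
      foldr _⊗_ (value main (φ [ v ≔ a ])) (map (λ F → value F (φ [ v ≔ a ])) touched) ∎) (allFin h)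
    where
    agree′ : ∀ {a w} → w ∈ˡ v ∷ vs → (rank w ≤ rank v → w ∈ front v) → (ψ [ v ≔ a ]) w ≡ (φ [ v ≔ a ]) w
    agree′ (here refl) _   = []≔-agree ψ φ v λ v≢v → ⊥-elim (v≢v refl)
    agree′ (there w∈)    w∈U = []≔-agree ψ φ v λ _ → agree w∈ (w∈U (rank≤ w∈))

  -- A factor whose scope misses `v` is constant while `v` varies, so distributivity takes it out of
  -- the sum.
  sumOut-product : ∀ {v vs main Fs} → All (λ F → Supported (v ∷ vs) F) Fs → ∀ ψ →
    sumOut v (product main Fs) ψ ≈
    product (message v main (filter (λ F → v ∈? scope F) Fs)) (filter (λ F → ¬? (v ∈? scope F)) Fs) ψ
  sumOut-product {v} {vs} {main} {Fs} sups ψ = begin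
      ∑ (map (λ a → product main Fs (ψ [ v ≔ a ])) (allFin h))
        ≈⟨ ∑-cong (λ a → begin
             value main (ψ [ v ≔ a ]) ⊗ ∏ (map (λ F → value F (ψ [ v ≔ a ])) Fs)
               ≈⟨ ⊗-cong ≋-refl (∏-filter v∈? (λ F → value F (ψ [ v ≔ a ])) Fs) ⟩
             value main (ψ [ v ≔ a ]) ⊗ (∏ (map (λ F → value F (ψ [ v ≔ a ])) touched) ⊗
                                         ∏ (map (λ F → value F (ψ [ v ≔ a ])) rest))
               ≈⟨ ⊗-assoc _ _ _ ⟨
             value main (ψ [ v ≔ a ]) ⊗ ∏ (map (λ F → value F (ψ [ v ≔ a ])) touched) ⊗
             ∏ (map (λ F → value F (ψ [ v ≔ a ])) rest)
               ≈⟨ ⊗-cong (≋-sym (foldr-⊗ _ (map (λ F → value F (ψ [ v ≔ a ])) touched)))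
                         (∏-cong (All.tabulate (untouched a))) ⟩
             foldr _⊗_ (value main (ψ [ v ≔ a ])) (map (λ F → value F (ψ [ v ≔ a ])) touched) ⊗
             ∏ (map (λ F → value F ψ) rest) ∎) (allFin h) ⟩
      ∑ (map (λ a → foldr _⊗_ (value main (ψ [ v ≔ a ])) (map (λ F → value F (ψ [ v ≔ a ])) touched) ⊗
                    ∏ (map (λ F → value F ψ) rest)) (allFin h))
        ≈⟨ ∑-⊗ʳ _ _ (allFin h) ⟩
      product (message v main touched) rest ψ ∎
    where
    v∈? = λ F → v ∈? scope F
    touched = filter v∈? Fs
    rest    = filter (¬? ∘ v∈?) Fs
    untouched : ∀ a {F} → F ∈ˡ rest → value F (ψ [ v ≔ a ]) ≈ value F ψ
    untouched a {F} F∈ with ∈-filter⁻ (¬? ∘ v∈?) {xs = Fs} F∈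
    ... | F∈Fs , v∉S = All.lookup sups F∈Fs (ψ [ v ≔ a ]) ψ λ {w} _ w∈S →
      updateAt-minimal w v ψ λ w≡v → v∉S (subst (_∈ scope F) w≡v w∈S)

  -- The base is `suc h` because a front may have fewer than `suc k` elements, and monotonicity in
  -- the exponent needs a positive base.
  tableSize : ℕ
  tableSize = suc h ^ suc k

  -- Each table entry takes `h` products of at most `L` multiplications and then `h` additions.
  messageCost : ℕ → ℕ
  messageCost L = tableSize * (h * L + h)

  -- Only the variants of `ψ₀` on `front v` are computed. Any assignment agrees on `front v` with
  -- one of them, and by support the two have the same value.
  reach-message : ∀ {ps v vs main touched L} → let g = message v main touched in
    length touched ≤ L → Assignment → Supported vs g →
    Program ps → (∀ ψ → Available ps (value main ψ)) →
    All (λ F → ∀ ψ → Multiplier ps (value F ψ)) touched →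
    ps reaches (λ qs → ∀ ψ → Available qs (value g ψ)) within messageCost L
  reach-message {ps} {v} {vs} {main} {touched} {L} len≤ ψ₀ sup prog av ms =
    weaken cost≤ (reach-each (value g) (h * L + h) table reach-entry prog >>= λ prog′ _ avs → done prog′ (everywhere avs))
    where
    g = message v main touched
    table = variants ψ₀ (elements (front v))
    summand : Assignment → Fin h → Poly R X
    summand ψ a = foldr _⊗_ (value main (ψ [ v ≔ a ])) (map (λ F → value F (ψ [ v ≔ a ])) touched)

    reach-entry : ∀ ψ {qs} → Program qs → ps ⊆ˡ qs →
                  qs reaches (λ rs → Available rs (value g ψ)) within h * L + h
    reach-entry ψ {qs} prog ps⊆qs =
      subst (λ n → qs reaches (λ rs → Available rs (value g ψ)) within n * L + n) (length-tabulate {n = h} id)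
      (reach-each (summand ψ) L (allFin h)
        (λ a {rs} prog′ qs⊆rs → weaken (≤-trans (≤-reflexive (length-map _ touched)) len≤)
          (reach-foldr-⊗ _ (map (λ F → value F (ψ [ v ≔ a ])) touched) prog′
            (available-⊆ (⊆-trans ps⊆qs qs⊆rs) (av _))
            (All.map⁺ (All.map (λ m → multiplier-⊆ (⊆-trans ps⊆qs qs⊆rs) (m _)) ms))))
        prog
       >>= λ prog′ _ avs → weaken (≤-reflexive (length-map (summand ψ) (allFin h)))
             (reach-∑ (map (summand ψ) (allFin h)) prog′ (All.map⁺ avs)))

    everywhere : ∀ {qs} → All (λ ρ → Available qs (value g ρ)) table → ∀ ψ → Available qs (value g ψ)
    everywhere avs ψ with ∈-variants ψ₀ (elements (front v)) ψ
    ... | ρ , ρ∈ , agree = available-cong (sup _ _ λ _ w∈ → agree (∈-elements w∈)) (All.lookup avs ρ∈)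

    cost≤ : length table * (h * L + h) + 0 ≤ messageCost L
    cost≤ = NR.begin
      length table * (h * L + h) + 0   NR.≡⟨ +-identityʳ _ ⟩
      length table * (h * L + h)       NR.≤⟨ *-monoˡ-≤ (h * L + h) (NR.begin
        length table                   NR.≡⟨ length-variants ψ₀ (elements (front v)) ⟩
        h ^ length (elements (front v)) NR.≡⟨ cong (h ^_) (length-elements (front v)) ⟩
        h ^ ∣ front v ∣                NR.≤⟨ ^-monoˡ-≤ ∣ front v ∣ (n≤1+n h) ⟩
        suc h ^ ∣ front v ∣            NR.≤⟨ ^-monoʳ-≤ (suc h) (small v) ⟩
        tableSize                      NR.∎) ⟩
      messageCost L                    NR.∎
      where module NR = ≤-Reasoning

  unit : Factor
  unit = record { scope = ∅ ; value = const 1# }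

  unit-product : ∀ F Fs ψ → product unit (F ∷ Fs) ψ ≈ product F Fs ψ
  unit-product F Fs ψ = ⊗-identityˡ _

  modes : ∀ m → m ≡ general ⊎ m ≡ skew
  modes general = inj₁ refl
  modes skew    = inj₂ refl

  -- Induction on the remaining vertices. The waiting factors must be multipliers, so in skew mode
  -- they are atomic; `main` need only be available, as it starts the running product. `B` bounds
  -- the factors present at any time and pays for the final product.
  eliminate : ∀ {ps main Fs B} vs → AllPairs (λ v w → rank w ≤ rank v) vs → (ψ₀ : Assignment) →
    Program ps → Covered vs main → Supported vs main → (∀ ψ → Available ps (value main ψ)) →
    All (λ F → Clique vs F × Supported vs F × (∀ ψ → Multiplier ps (value F ψ))) Fs →
    length Fs + length vs ≤ B →
    ps reaches (λ qs → Available qs (sumOutAll vs (product main Fs) ψ₀)) within length vs * messageCost B + B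
  eliminate {main = main} {Fs} {B} [] _ ψ₀ prog cov sup av good len≤ =
    weaken (≤-trans (≤-reflexive (trans (+-identityʳ _) (length-map (λ F → value F ψ₀) Fs))) (≤-trans (m≤m+n _ 0) len≤))
      (reach-foldr-⊗ (value main ψ₀) (map (λ F → value F ψ₀) Fs) prog (av ψ₀)
        (All.map⁺ (All.map (λ { (_ , _ , m) → m ψ₀ }) good))
       >>= λ prog′ _ av′ → done {cost = 0} prog′ (available-cong (foldr-⊗ _ (map (λ F → value F ψ₀) Fs)) av′))
  eliminate {ps} {main} {Fs} {B} (v ∷ vs) (rank≤ ∷ sorted) ψ₀ prog cov sup av good len≤ =
    weaken (≤-reflexive (sym (+-assoc (messageCost B) _ B)))
      (reach-message {vs = vs} {main = main} touched≤ ψ₀ sup′ prog av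
         (All.tabulate λ F∈ → proj₂ (proj₂ (All.lookup good (proj₁ (∈-filter⁻ v∈? {xs = Fs} F∈)))))
       >>= λ prog′ ⊆ av′ → continue prog′ ⊆ av′ (modes mode))
    where
    v∈? = λ F → v ∈? scope F
    touched = filter v∈? Fs
    rest    = filter (¬? ∘ v∈?) Fs
    g = message v main touched

    touched≤ : length touched ≤ B
    touched≤ = ≤-trans (length-filter v∈? Fs) (≤-trans (m≤m+n _ _) len≤)

    -- The eliminated vertex makes room for the message that may join `rest`.
    rest≤ : suc (length rest) + length vs ≤ B
    rest≤ = ≤-trans (≤-reflexive (sym (+-suc (length rest) (length vs))))
              (≤-trans (+-monoˡ-≤ (suc (length vs)) (length-filter (¬? ∘ v∈?) Fs)) len≤)

    sup′ : Supported vs g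
    sup′ = message-supported (λ w∈ → All.lookup rank≤ w∈) cov sup
      (All.tabulate λ F∈ → let (F∈Fs , v∈S) = ∈-filter⁻ v∈? {xs = Fs} F∈
                               (cl , s , _) = All.lookup good F∈Fs in v∈S , cl , s)

    summed : ∀ ψ → product g rest ψ ≈ sumOut v (product main Fs) ψ
    summed ψ = ≋-sym (sumOut-product {main = main} (All.map (λ { (_ , s , _) → s }) good) ψ)

    rest-good : ∀ {qs} → ps ⊆ˡ qs →
      All (λ F → Clique vs F × Supported vs F × (∀ ψ → Multiplier qs (value F ψ))) rest
    rest-good ⊆ = All.tabulate λ {F} F∈ →
      let (F∈Fs , v∉S) = ∈-filter⁻ (¬? ∘ v∈?) {xs = Fs} F∈
          (cl , s , m) = All.lookup good F∈Fs in
      (λ x∈ y∈ → cl (there x∈) (there y∈)) ,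
      -- The scope misses `v`, so dropping `v` from the list keeps the factor supported.
      (λ ψ φ agree → s ψ φ λ { (here refl) v∈S → ⊥-elim (v∉S v∈S) ; (there w∈) → agree w∈ }) ,
      λ ψ → multiplier-⊆ ⊆ (m ψ)

    continue : ∀ {qs} → Program qs → ps ⊆ˡ qs → (∀ ψ → Available qs (value g ψ)) →
      mode ≡ general ⊎ mode ≡ skew →
      qs reaches (λ rs → Available rs (sumOutAll (v ∷ vs) (product main Fs) ψ₀)) within
        length vs * messageCost B + B
    -- General mode: the message joins the waiting factors, with `closed` as its clique condition,
    -- and `main` is the unit again.
    continue prog′ ⊆ av′ (inj₁ refl) = weaken (≤-reflexive (+-identityʳ _))
      (eliminate {main = unit} {Fs = g ∷ rest} vs sorted ψ₀ prog′
         (λ _ _ w∈∅ → ⊥-elim (∉⊥ w∈∅)) (λ _ _ _ → ≋-refl) (λ _ → inj₁ (inj₂ (_ , ≋-refl)))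
         (((λ x∈ y∈ x∈S y∈S y≤x → closed (All.lookup rank≤ x∈) y≤x x∈S y∈S) ,
           sup′ , λ ψ → inj₂ (refl , av′ ψ)) ∷ rest-good ⊆)
         rest≤
       >>= λ prog″ _ av″ → done prog″
         (available-cong (sumOutAll-cong vs (λ ψ → ≋-trans (unit-product g rest ψ) (summed ψ)) ψ₀) av″))
    -- Skew mode: the message becomes `main`, and `closed` yields `Covered` at every later vertex.
    continue prog′ ⊆ av′ (inj₂ refl) = weaken (≤-reflexive (+-identityʳ _))
      (eliminate {main = g} {Fs = rest} vs sorted ψ₀ prog′
         (λ x∈ _ y∈S y≤x → closed (All.lookup rank≤ x∈) y≤x tt y∈S)
         sup′ av′ (rest-good ⊆) (≤-trans (n≤1+n _) rest≤)
       >>= λ prog″ _ av″ → done prog″ (available-cong (sumOutAll-cong vs summed ψ₀) av″))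

-- Counting edges and variables

length-edges : ∀ G → length (edges G) ≤ order G * order G
length-edges G = ≤-trans (length-mapMaybe _ pairs) (≤-reflexive (trans
  (length-cartesianProductWith _,_ (allFin (order G)) (allFin (order G)))
  (cong₂ _*_ (length-tabulate {n = order G} id) (length-tabulate {n = order G} id))))
  where pairs = cartesianProduct (allFin (order G)) (allFin (order G))

edges-complete : ∀ G {u v} → u Fin.< v → Graph._~_ G u v →
                 Any (λ e → Edge.src e ≡ u × Edge.tgt e ≡ v) (edges G)
edges-complete G {u} {v} u<v u~v =
  Any.mapMaybe⁺ _ _ (Any.map⁺ (Any.map (λ { refl → just-yes ((u Fin.<? v) ×-dec T? (Graph.adj G u v)) (u<v , u~v) (λ _ → refl , refl) })
    (∈-cartesianProduct⁺ (∈-allFin u) (∈-allFin v))))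
  where
  just-yes : ∀ {A B : Set} {P : B → Set} {g : A → B} (d : Dec A) → A → (∀ a → P (g a)) →
             MAny.Any P (Maybe.map g (dec⇒maybe d))
  just-yes (yes a) _ p = MAny.just (p a)
  just-yes (no ¬a) a _ = ⊥-elim (¬a a)

module _ (G H : Graph) where

  varIndex : HomVar G H → Fin (order G * order H + order H * order H)
  varIndex (Z u a) = combine u a ↑ˡ (order H * order H)
  varIndex (Y e)   = (order G * order H) ↑ʳ combine (Edge.src e) (Edge.tgt e)

  -- The endpoints determine an edge, since the proofs of order and adjacency are unique.
  varIndex-injective : ∀ {x y} → varIndex x ≡ varIndex y → x ≡ y
  varIndex-injective {Z u a} {Z v b} eq with Fin.combine-injective u a v b (Fin.↑ˡ-injective _ _ _ eq)
  ... | refl , refl = refl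
  varIndex-injective {Z u a} {Y e} eq = case trans (sym (Fin.splitAt-↑ˡ (order G * order H) _ _))
    (trans (cong (Fin.splitAt (order G * order H)) eq) (Fin.splitAt-↑ʳ (order G * order H) _ _)) of λ ()
  varIndex-injective {Y e} {Z u a} eq = case trans (sym (Fin.splitAt-↑ˡ (order G * order H) _ _))
    (trans (cong (Fin.splitAt (order G * order H)) (sym eq)) (Fin.splitAt-↑ʳ (order G * order H) _ _)) of λ ()
  varIndex-injective {Y (mkEdge a b a<b a~b)} {Y (mkEdge a′ b′ a′<b′ a′~b′)} eq
    with Fin.combine-injective a b a′ b′ (Fin.↑ʳ-injective _ _ _ eq)
  ... | refl , refl
    with refl ← Fin.<-irrelevant a<b a′<b′ | refl ← T-irrelevant a~b a′~b′ = refl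

-- The homomorphism polynomial

module HomPolynomial {c ℓ} (R : CommutativeRing c ℓ) (G H : Graph) where

  open Sums R {HomVar G H}
  open SetoidReasoning setoid
  open Graph H using () renaming (adj to adjH; _~_ to _~ᴴ_; ~-sym to ~ᴴ-sym)

  private
    n = order G
    h = order H

  edgeWeight : Vertex H → Vertex H → Poly R (HomVar G H)
  edgeWeight a b with T? (adjH a b)
  ... | yes a~b = var (Y (edge H a b a~b))
  ... | no  _   = 0#

  edgeWeight-yes : ∀ {a b} (a~b : a ~ᴴ b) → edgeWeight a b ≡ var (Y (edge H a b a~b))
  edgeWeight-yes {a} {b} a~b with T? (adjH a b)
  ... | yes a~b′ = cong (λ e → var (Y (edge H a b e))) (T-irrelevant a~b′ a~b)
  ... | no a≁b   = ⊥-elim (a≁b a~b)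

  edgeWeight-no : ∀ {a b} → ¬ a ~ᴴ b → edgeWeight a b ≡ 0#
  edgeWeight-no {a} {b} a≁b with T? (adjH a b)
  ... | yes a~b = ⊥-elim (a≁b a~b)
  ... | no _    = refl

  vertexTerm : (Vertex G → Vertex H) → Vertex G → Poly R (HomVar G H)
  vertexTerm ψ u = var (Z u (ψ u))

  edgeTerm : (Vertex G → Vertex H) → Edge G → Poly R (HomVar G H)
  edgeTerm ψ e = edgeWeight (ψ (Edge.src e)) (ψ (Edge.tgt e))

  weight : (Vertex G → Vertex H) → Poly R (HomVar G H)
  weight ψ = ∏ (map (vertexTerm ψ) (allFin n)) ⊗ ∏ (map (edgeTerm ψ) (edges G))

  weight-ext : Extensional weight
  weight-ext ψ≗φ = ⊗-cong
    (∏-cong {xs = allFin n} (All.tabulate λ {u} _ → reflexive (cong (λ a → var (Z u a)) (ψ≗φ u))))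
    (∏-cong {xs = edges G} (All.tabulate λ {e} _ → reflexive (cong₂ edgeWeight (ψ≗φ _) (ψ≗φ _))))

  -- Stored edges have increasing endpoints, so the pair may occur reversed in the list; symmetry of
  -- `H` carries the violation over.
  violation : ∀ {φ : Vertex G → Vertex H} {u v} → Graph._~_ G u v → ¬ φ u ~ᴴ φ v →
              Any (λ e → edgeTerm φ e ≈ 0#) (edges G)
  violation {φ} {u} {v} u~v φu≁φv with Fin.<-cmp u v
  ... | tri< u<v _ _ = Any.map (λ { (refl , refl) → reflexive (edgeWeight-no φu≁φv) })
                         (edges-complete G u<v u~v)
  ... | tri≈ _ refl _ = ⊥-elim (Graph.~-irrefl G u~v)
  ... | tri> _ _ v<u = Any.map (λ { (refl , refl) → reflexive (edgeWeight-no (φu≁φv ∘ ~ᴴ-sym)) })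
                         (edges-complete G v<u (Graph.~-sym G u~v))

  -- Over finitely many vertices, a decidable condition that fails has a counterexample, here an
  -- edge of `G` whose term is zero.
  weight-zero : ∀ {φ} → ¬ IsHom G H φ → weight φ ≈ 0#
  weight-zero {φ} ¬hom
    with u , ¬u ← Fin.¬∀⟶∃¬ n _ (λ u → Fin.all? λ v → T? (Graph.adj G u v) →-dec T? (adjH (φ u) (φ v))) ¬hom
    with v , ¬v ← Fin.¬∀⟶∃¬ n _ (λ v → T? (Graph.adj G u v) →-dec T? (adjH (φ u) (φ v))) ¬u
    with T? (Graph.adj G u v)
  ... | no u≁v  = ⊥-elim (¬v λ u~v → ⊥-elim (u≁v u~v))
  ... | yes u~v = ≋-trans (⊗-cong ≋-refl (∏-zero (Any.map⁺ (violation {φ} u~v (λ φu~φv → ¬v λ _ → φu~φv))))) (⊗-zeroʳ _)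

  -- Discarded maps have weight zero and may be put back. The function `m` stands for the monomial
  -- that is local to `f̂`, and the list is arbitrary for the induction.
  ∑-homs : ∀ {m : Hom G H → Poly R (HomVar G H)} → (∀ φ → m φ ≈ weight (proj₁ φ)) → ∀ φs →
    ∑ (map m (mapMaybe (λ φ → Maybe.map (φ ,_) (dec⇒maybe (isHom? G H φ))) φs)) ≈ ∑ (map weight φs)
  ∑-homs m≈ []       = ≋-refl
  ∑-homs m≈ (φ ∷ φs) with isHom? G H φ
  ... | yes hom  = ⊕-cong (m≈ (φ , hom)) (∑-homs m≈ φs)
  ... | no ¬hom = ≋-trans (∑-homs m≈ φs)
    (≋-sym (≋-trans (⊕-cong (weight-zero ¬hom) ≋-refl) (⊕-identityˡ _)))

  f̂≈∑weight : f̂ R G H ≈ ∑ (map weight (map finToFun (allFin (h ^ n))))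
  f̂≈∑weight = ∑-homs (λ { (φ , hom) → ⊗-cong ≋-refl
    (∏-cong {xs = edges G} (All.tabulate λ {e} _ →
       reflexive (sym (edgeWeight-yes (hom _ _ (Edge.adjacent e)))))) }) (map finToFun (allFin (h ^ n)))

  -- Each homomorphism gives one term, with one variable per vertex and one per edge of `G`.
  degree : Degree≤ R (n + n * n) (f̂ R G H)
  degree = map term (homs G H) ,
    All.map⁺ (All.tabulate λ {φ} _ → ≤-trans (≤-reflexive (length-term φ)) (+-monoʳ-≤ n (length-edges G))) ,
    (begin
      f̂ R G H                            ≈⟨ ∑-cong term≈ (homs G H) ⟩
      ∑ (map (⟦_⟧ₜ R ∘ term) (homs G H))   ≡⟨ cong ∑ (map-∘ (homs G H)) ⟩
      ∑ (map (⟦_⟧ₜ R) (map term (homs G H))) ∎)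
    where
    term : Hom G H → Term R (HomVar G H)
    term φ = CommutativeRing.1# R ,
      map (λ u → Z u (proj₁ φ u)) (allFin n) ++ map (λ e → Y (mapEdge φ e)) (edges G)
    length-term : ∀ φ → length (proj₂ (term φ)) ≡ n + length (edges G)
    length-term φ = trans (length-++ (map (λ u → Z u (proj₁ φ u)) (allFin n)))
      (cong₂ _+_ (trans (length-map _ (allFin n)) (length-tabulate {n = n} id)) (length-map _ (edges G)))
    term≈ : ∀ φ → ∏ (map (λ u → var (Z u (proj₁ φ u))) (allFin n)) ⊗
                  ∏ (map (λ e → var (Y (mapEdge φ e))) (edges G)) ≈ ⟦_⟧ₜ R (term φ)
    term≈ φ = ≋-sym (begin
      1# ⊗ ∏ (map var (zs ++ ys))          ≈⟨ ⊗-identityˡ _ ⟩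
      ∏ (map var (zs ++ ys))               ≡⟨ cong ∏ (map-++ var zs ys) ⟩
      ∏ (map var zs ++ map var ys)         ≈⟨ ∏-++ (map var zs) (map var ys) ⟩
      ∏ (map var zs) ⊗ ∏ (map var ys)      ≡⟨ cong₂ (λ p q → ∏ p ⊗ ∏ q) (map-∘ (allFin n)) (map-∘ (edges G)) ⟨
      ∏ (map (λ u → var (Z u (proj₁ φ u))) (allFin n)) ⊗
      ∏ (map (λ e → var (Y (mapEdge φ e))) (edges G)) ∎)
      where
      zs = map (λ u → Z u (proj₁ φ u)) (allFin n)
      ys = map (λ e → Y (mapEdge φ e)) (edges G)

  -- Bounds the initial `length Fs + length vs`: vertex factors, edge factors, vertices to
  -- eliminate.
  factorBound : ℕ
  factorBound = n + n * n + n

  -- The cost of `eliminate` with `B` equal to `factorBound`, written out so as to depend on the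
  -- width alone and not on a scheme.
  circuitSize : ℕ → ℕ
  circuitSize k = n * (suc h ^ suc k * (h * factorBound + h)) + factorBound

  module _ {mode k} (scheme : Scheme mode k G) where

    open Scheme scheme
    open Elimination R (HomVar G H) scheme h
    open Programs R (HomVar G H) mode

    byDecreasingRank : DecTotalOrder _ _ _
    byDecreasingRank = On.decTotalOrder (Flip.decTotalOrder ≤-decTotalOrder) rank

    ordering : List (Vertex G)
    ordering = Sort.sort byDecreasingRank (allFin n)

    ordering-sorted : AllPairs (λ v w → rank w ≤ rank v) ordering
    ordering-sorted = Sorted⇒AllPairs (DecTotalOrder.totalOrder byDecreasingRank) (Sort.sort-↗ byDecreasingRank (allFin n))

    ordering-↭ : ordering ↭ allFin n
    ordering-↭ = Sort.sort-↭ byDecreasingRank (allFin n)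

    length-ordering : length ordering ≡ n
    length-ordering = trans (↭-length ordering-↭) (length-tabulate {n = n} id)

    vertexFactor : Vertex G → Factor
    vertexFactor u = record { scope = ⁅ u ⁆ ; value = λ ψ → vertexTerm ψ u }

    edgeFactor : Edge G → Factor
    edgeFactor e = record { scope = ⁅ Edge.src e ⁆ ∪ ⁅ Edge.tgt e ⁆ ; value = λ ψ → edgeTerm ψ e }

    factors : List Factor
    factors = map vertexFactor (allFin n) ++ map edgeFactor (edges G)

    length-factors : length factors + length ordering ≤ factorBound
    length-factors = +-mono-≤
      (≤-trans (≤-reflexive (trans (length-++ (map vertexFactor (allFin n)))
                  (cong₂ _+_ (trans (length-map _ (allFin n)) (length-tabulate {n = n} id)) (length-map _ (edges G)))))
               (+-monoʳ-≤ n (length-edges G)))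
      (≤-reflexive length-ordering)

    product-weight : ∀ ψ → product unit factors ψ ≈ weight ψ
    product-weight ψ = begin
      1# ⊗ ∏ (map val factors)    ≈⟨ ⊗-identityˡ _ ⟩
      ∏ (map val factors)         ≡⟨ cong ∏ (map-++ val (map vertexFactor (allFin n)) (map edgeFactor (edges G))) ⟩
      ∏ (map val (map vertexFactor (allFin n)) ++ map val (map edgeFactor (edges G)))
        ≈⟨ ∏-++ (map val (map vertexFactor (allFin n))) _ ⟩
      ∏ (map val (map vertexFactor (allFin n))) ⊗ ∏ (map val (map edgeFactor (edges G)))
        ≡⟨ cong₂ (λ p q → ∏ p ⊗ ∏ q) (map-∘ (allFin n)) (map-∘ (edges G)) ⟨
      weight ψ                    ∎
      where
      val : Factor → Poly R (HomVar G H)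
      val F = value F ψ

    edgeWeight-atomic : ∀ a b → Atomic (edgeWeight a b)
    edgeWeight-atomic a b with T? (adjH a b)
    ... | yes _ = inj₁ (_ , ≋-refl)
    ... | no _  = inj₂ (_ , ≋-refl)

    Good : Factor → Set _
    Good F = Clique ordering F × Supported ordering F × (∀ ψ → Multiplier [] (value F ψ))

    ∈ordering : ∀ u → u ∈ˡ ordering
    ∈ordering u = ∈-resp-↭ (Perm.↭-sym ordering-↭) (∈-allFin u)

    vertexFactor-good : ∀ u → Good (vertexFactor u)
    vertexFactor-good u =
      (λ { _ _ v∈ w∈ _ → singleton (x∈⁅y⁆⇒x≡y u v∈) (x∈⁅y⁆⇒x≡y u w∈) }) ,
      (λ ψ φ agree → reflexive (cong (λ a → var (Z u a)) (agree (∈ordering u) (x∈⁅x⁆ u)))) ,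
      λ ψ → inj₁ (inj₁ (_ , ≋-refl))
      where
      singleton : ∀ {v w} → v ≡ u → w ≡ u → w ∈ front v
      singleton refl refl = self u

    -- Two different endpoints satisfy the clique condition by `edge∈`, in either orientation; equal
    -- ones do by `self`.
    edgeFactor-good : ∀ e → Good (edgeFactor e)
    edgeFactor-good e@(mkEdge s t _ s~t) =
      (λ { _ _ v∈ w∈ → pair (x∈p∪q⁻ ⁅ s ⁆ ⁅ t ⁆ v∈) (x∈p∪q⁻ ⁅ s ⁆ ⁅ t ⁆ w∈) }) ,
      (λ ψ φ agree → reflexive (cong₂ edgeWeight
        (agree (∈ordering s) (x∈p∪q⁺ (inj₁ (x∈⁅x⁆ s)))) (agree (∈ordering t) (x∈p∪q⁺ {p = ⁅ s ⁆} (inj₂ (x∈⁅x⁆ t)))))) ,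
      λ ψ → inj₁ (edgeWeight-atomic _ _)
      where
      pair : ∀ {v w} → v ∈ ⁅ s ⁆ ⊎ v ∈ ⁅ t ⁆ → w ∈ ⁅ s ⁆ ⊎ w ∈ ⁅ t ⁆ → rank w ≤ rank v → w ∈ front v
      pair (inj₁ v∈) (inj₁ w∈) le with refl ← x∈⁅y⁆⇒x≡y s v∈ | refl ← x∈⁅y⁆⇒x≡y s w∈ = self s
      pair (inj₁ v∈) (inj₂ w∈) le with refl ← x∈⁅y⁆⇒x≡y s v∈ | refl ← x∈⁅y⁆⇒x≡y t w∈ = edge∈ s~t le
      pair (inj₂ v∈) (inj₁ w∈) le with refl ← x∈⁅y⁆⇒x≡y t v∈ | refl ← x∈⁅y⁆⇒x≡y s w∈ = edge∈ (Graph.~-sym G s~t) le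
      pair (inj₂ v∈) (inj₂ w∈) le with refl ← x∈⁅y⁆⇒x≡y t v∈ | refl ← x∈⁅y⁆⇒x≡y t w∈ = self t

    factors-good : All Good factors
    factors-good = All.++⁺ (All.map⁺ {xs = allFin n} (All.tabulate λ {u} _ → vertexFactor-good u))
                           (All.map⁺ {xs = edges G} (All.tabulate λ {e} _ → edgeFactor-good e))

    f̂≈sumOutAll : ∀ ψ₀ → sumOutAll ordering (product unit factors) ψ₀ ≈ f̂ R G H
    f̂≈sumOutAll ψ₀ = begin
      sumOutAll ordering (product unit factors) ψ₀           ≈⟨ sumOutAll-cong ordering product-weight ψ₀ ⟩
      sumOutAll ordering weight ψ₀                           ≈⟨ sumOutAll-↭ weight-ext ordering-↭ ψ₀ ⟩
      sumOutAll (allFin n) weight ψ₀                   ≈⟨ ∑-finToFun n weight-ext ψ₀ ⟨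
      ∑ (map weight (map finToFun (allFin (h ^ n))))   ≈⟨ f̂≈∑weight ⟨
      f̂ R G H                                          ∎

    reach-f̂ : (Vertex G → Vertex H) → [] reaches (λ qs → Available qs (f̂ R G H)) within circuitSize k
    reach-f̂ ψ₀ = weaken (≤-reflexive (trans (+-identityʳ _) (cong (λ l → l * messageCost factorBound + factorBound) length-ordering)))
      (eliminate {main = unit} ordering ordering-sorted ψ₀ []
        (λ _ _ w∈∅ → ⊥-elim (∉⊥ w∈∅)) (λ _ _ _ → ≋-refl) (λ _ → inj₁ (inj₂ (_ , ≋-refl)))
        factors-good length-factors
       >>= λ prog _ av → done prog (available-cong (f̂≈sumOutAll ψ₀) av))

    record CircuitFor (p : Poly R (HomVar G H)) : Set (c ⊔ ℓ) where
      field
        circuit  : Circuit R (HomVar G H)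
        size≤    : Circuit.size circuit ≤ circuitSize k
        skewness : mode ≡ skew → Skew R circuit
        computes : _Computes_ R circuit p

    circuitFor : CircuitFor (f̂ R G H)
    circuitFor = by-homs (homs G H) refl
      where
      ∑-empty : ∀ {a} {A : Set a} {f : A → Poly R (HomVar G H)} {xs} → xs ≡ [] → ∑ (map f xs) ≡ 0#
      ∑-empty refl = refl

      -- With no homomorphism there may be no assignment to start the elimination from.
      by-homs : ∀ φs → homs G H ≡ φs → CircuitFor (f̂ R G H)
      by-homs [] eq = record
        { circuit  = record { size = 0 ; gates = [] ; output = constant _ }
        ; size≤    = z≤n
        ; skewness = λ _ → tt
        ; computes = ≋-sym (reflexive (∑-empty eq))
        }
      by-homs (φ ∷ _) _ = record
        { circuit  = record { size = _ ; gates = Compiled.gates C ; output = input (goal r) }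
        ; size≤    = ≤-trans (bound r) (≤-reflexive (+-identityʳ _))
        ; skewness = Compiled.isSkew C
        ; computes = evalInput-input _ (Compiled.correct C) (goal r)
        }
        where
        r = reach-f̂ (proj₁ φ)
        C = compile (program r)

-- Families of circuits of polynomial size

module _ {c ℓ} (R : CommutativeRing c ℓ) (G H : ℕ → Graph)
         (H-bounded : PolyBounded (order ∘ H)) (G-bounded : PolyBounded (order ∘ G)) where

  private
    n h : ℕ → ℕ
    n = order ∘ G
    h = order ∘ H

    n-bounded : PolyBounded′ n
    n-bounded = fromPolyBounded G-bounded

    h-bounded : PolyBounded′ h
    h-bounded = fromPolyBounded H-bounded

  isPFamily : IsPFamily R (λ m → f̂ R (G m) (H m))
  isPFamily = record
    { numVars        = λ m → n m * h m + h m * h m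
    ; variables      = λ m → mk↣ (varIndex-injective (G m) (H m))
    ; numVarsBounded = toPolyBounded (+-polyBounded (*-polyBounded n-bounded h-bounded) (*-polyBounded h-bounded h-bounded))
    ; degree         = λ m → n m + n m * n m
    ; hasDegree      = λ m → HomPolynomial.degree R (G m) (H m)
    ; degreeBounded  = toPolyBounded (+-polyBounded n-bounded (*-polyBounded n-bounded n-bounded))
    }

  -- Bounded width enters here: the exponent `suc k` of the table size is the same for all `m`.
  size-bounded : ∀ k → PolyBounded′ (λ m → HomPolynomial.circuitSize R (G m) (H m) k)
  size-bounded k = +-polyBounded
    (*-polyBounded n-bounded (*-polyBounded (^-polyBounded (+-polyBounded (const-polyBounded 1) h-bounded) (suc k))
      (+-polyBounded (*-polyBounded h-bounded B-bounded) h-bounded)))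
    B-bounded
    where
    B-bounded = +-polyBounded (+-polyBounded n-bounded (*-polyBounded n-bounded n-bounded)) n-bounded

  module _ {mode k} (scheme : ∀ m → Scheme mode k (G m)) where

    circuitsFor : ∀ m → HomPolynomial.CircuitFor R (G m) (H m) (scheme m) (f̂ R (G m) (H m))
    circuitsFor m = HomPolynomial.circuitFor R (G m) (H m) (scheme m)

    open module C m = HomPolynomial.CircuitFor (circuitsFor m) public

    circuits-bounded : PolyBounded (λ m → Circuit.size (circuit m))
    circuits-bounded = toPolyBounded (mono-polyBounded size≤ (size-bounded k))

theorem3 : ∀ {c ℓ} (R : CommutativeRing c ℓ) (H G : ℕ → Graph) →
    IsGraphPFamily H → (∀ m → Complete (H m)) →
    IsGraphPFamily G →
    (BoundedTreeWidth G → VP R (λ m → f̂ R (G m) (H m))) ×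
    (BoundedPathWidth G → VBP R (λ m → f̂ R (G m) (H m)))
theorem3 R H G H-bounded _ G-bounded =
  (λ { (k , width≤) → let scheme = treeScheme ∘ width≤ in
     isPFamily R G H H-bounded G-bounded ,
     circuit R G H H-bounded G-bounded scheme ,
     circuits-bounded R G H H-bounded G-bounded scheme ,
     computes R G H H-bounded G-bounded scheme }) ,
  (λ { (k , width≤) → let scheme = pathScheme ∘ width≤ in
     isPFamily R G H H-bounded G-bounded ,
     circuit R G H H-bounded G-bounded scheme ,
     circuits-bounded R G H H-bounded G-bounded scheme ,
     (λ m → skewness R G H H-bounded G-bounded scheme m refl) ,
     computes R G H H-bounded G-bounded scheme })
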